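{- The $\lambda^{\textsc{prk}}$-calculus is strongly normalizing: there is no infinite reduction sequence $t_1\to t_2\to t_3\to\cdots$ starting from a typable term $t_1$ of $\lambda^{\textsc{prk}}$.
   Context: **Types.** Fix a denumerable set of propositional variables $\alpha$. Pure propositions: $A,B ::= \alpha \mid A\land B\mid A\lor B\mid \neg A$. Types (moded propositions): $P,Q ::= A^+\mid A^-\mid A^\oplus\mid A^\ominus$; $A^+,A^-$ are strong, $A^\oplus,A^\ominus$ classical. Opposite: $(A^+)^\sim=A^-$, $(A^-)^\sim=A^+$, $(A^\oplus)^\sim=A^\ominus$, $(A^\ominus)^\sim=A^\oplus$. **Terms of $\lambda^{\textsc{prk}}$.** ($i\in\{1,2\}$, $\pm\in\{+,-\}$; $x,y$ from a denumerable set of variables) $$t,s,u ::= x \mid t\blacktriangleright\!\blacktriangleleft_P s\mid \langle t,s\rangle^\pm\mid \pi_i^\pm(t)\mid \mathsf{in}_i^\pm(t)\mid \delta^\pm t[_{x:P}.s][_{y:Q}.u]\mid \nu^\pm t\mid \mu^\pm t\mid \mathsf{IC}^\pm_{(x:P)}.t\mid t\bullet^\pm s.$$ In $\delta^\pm t[_{x:P}.s][_{y:Q}.u]$, $x$ is bound in $s$ and $y$ in $u$; in $\mathsf{IC}^\pm_{(x:P)}.t$, $x$ is bound in $t$. Terms are taken modulo $\alpha$-renaming; $t[x:=s]$ is capture-avoiding substitution. Type annotations may be omitted. **Typing.** Typing contexts $\Gamma$ are finite lists $x_1:P_1,\dots,x_n:P_n$ with distinct variables, up to reordering. A term $t$ is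 typable if $\Gamma\vdash t:P$ for some $\Gamma,P$. Rules: - (Ax) $\Gamma,x:P\vdash x:P$. (Abs) $\Gamma\vdash t:P$, $\Gamma\vdash s:P^\sim$, $P$ strong $\Rightarrow$ $\Gamma\vdash t\blacktriangleright\!\blacktriangleleft_Q s:Q$. - $\Gamma\vdash t:A^\oplus$, $\Gamma\vdash s:B^\oplus$ $\Rightarrow$ $\Gamma\vdash\langle t,s\rangle^+:(A\land B)^+$. $\Gamma\vdash t:A^\ominus$, $\Gamma\vdash s:B^\ominus$ $\Rightarrow$ $\Gamma\vdash\langle t,s\rangle^-:(A\lor B)^-$. - $\Gamma\vdash t:(A_1\land A_2)^+$ $\Rightarrow$ $\Gamma\vdash\pi^+_i(t):A_i^\oplus$. $\Gamma\vdash t:(A_1\lor A_2)^-$ $\Rightarrow$ $\Gamma\vdash\pi^-_i(t):A_i^\ominus$. - $\Gamma\vdash t:A_i^\oplus$ $\Rightarrow$ $\Gamma\vdash\mathsf{in}^+_i(t):(A_1\lor A_2)^+$. $\Gamma\vdash t:A_i^\ominus$ $\Rightarrow$ $\Gamma\vdash\mathsf{in}^-_i(t):(A_1\land A_2)^-$. - $\Gamma\vdash t:(A\lor B)^+$, $\Gamma,x:A^\oplus\vdash s:P$, $\Gamma,y:B^\oplus\vdash u:P$ $\Rightarrow$ $\Gamma\vdash\delta^+t[_{x:A^\oplus}.s][_{y:B^\oplus}.u]:P$. $\Gamma\vdash t:(A\land B)^-$, $\Gamma,x:A^\ominus\vdash s:P$, $\Gamma,y:B^\ominus\vdash u:P$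 $\Rightarrow$ $\Gamma\vdash\delta^-t[_{x:A^\ominus}.s][_{y:B^\ominus}.u]:P$. - $\Gamma\vdash t:A^\ominus$ $\Rightarrow$ $\Gamma\vdash\nu^+t:(\neg A)^+$. $\Gamma\vdash t:A^\oplus$ $\Rightarrow$ $\Gamma\vdash\nu^-t:(\neg A)^-$. $\Gamma\vdash t:(\neg A)^+$ $\Rightarrow$ $\Gamma\vdash\mu^+t:A^\ominus$. $\Gamma\vdash t:(\neg A)^-$ $\Rightarrow$ $\Gamma\vdash\mu^-t:A^\oplus$. - $\Gamma,x:A^\ominus\vdash t:A^+$ $\Rightarrow$ $\Gamma\vdash\mathsf{IC}^+_{(x:A^\ominus)}.t:A^\oplus$. $\Gamma,x:A^\oplus\vdash t:A^-$ $\Rightarrow$ $\Gamma\vdash\mathsf{IC}^-_{(x:A^\oplus)}.t:A^\ominus$. - $\Gamma\vdash t:A^\oplus$, $\Gamma\vdash s:A^\ominus$ $\Rightarrow$ $\Gamma\vdash t\bullet^+s:A^+$. $\Gamma\vdash t:A^\ominus$, $\Gamma\vdash s:A^\oplus$ $\Rightarrow$ $\Gamma\vdash t\bullet^-s:A^-$. **Generalized absurdity.** For $t:P$ and $s:P^\sim$, $t\bowtie_Q s$ denotes: $t\blacktriangleright\!\blacktriangleleft_Q s$ if $P$ is strong; $(t\bullet^+s)\blacktriangleright\!\blacktriangleleft_Q(s\bullet^-t)$ if $P=A^\oplus$; $(t\bullet^-s)\blacktriangleright\!\blacktriangleleft_Q(s\bullet^+t)$ if $P=A^\ominus$. **Reduction.**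 $\to$ is defined on typable terms as the closure under arbitrary contexts of the following rules (in each rule all $\pm$ denote the same sign, $\mp$ the opposite sign, and $i\in\{1,2\}$): - $\pi_i^\pm(\langle t_1,t_2\rangle^\pm)\to t_i$; - $\delta^\pm(\mathsf{in}_i^\pm(t))[_x.s_1][_x.s_2]\to s_i[x:=t]$; - $\mu^\pm(\nu^\pm t)\to t$; - $(\mathsf{IC}^\pm_x.t)\bullet^\pm s\to t[x:=s]$; - $\langle t_1,t_2\rangle^\pm\blacktriangleright\!\blacktriangleleft_Q\mathsf{in}_i^\mp(s)\to t_i\bowtie_Q s$; - $\mathsf{in}_i^\pm(t)\blacktriangleright\!\blacktriangleleft_Q\langle s_1,s_2\rangle^\mp\to t\bowtie_Q s_i$; - $(\nu^\pm t)\blacktriangleright\!\blacktriangleleft_Q(\nu^\mp s)\to t\bowtie_Q s$. -}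

module Defs where

open import Data.Fin using (Fin; zero; suc)
open import Data.Nat using (ℕ; suc)
open import Data.Product using (∃-syntax)
open import Data.Sign using (Sign; +; -; opposite)
open import Data.Vec using (Vec; _∷_; lookup)

infixr 8 _∧_
infixr 7 _∨_
infix  6 _⁺ _⁻ _⊕ _⊖
infix  6 _~

data Pure : Set where
  atom : ℕ → Pure
  _∧_  : Pure → Pure → Pure
  _∨_  : Pure → Pure → Pure
  neg  : Pure → Pure

data Type : Set where
  _⁺ _⁻ _⊕ _⊖ : Pure → Type

data Strong : Type → Set where
  strong⁺ : ∀ {A} → Strong (A ⁺)
  strong⁻ : ∀ {A} → Strong (A ⁻)

_~ : Type → Type
(A ⁺) ~ = A ⁻
(A ⁻) ~ = A ⁺
(A ⊕) ~ = A ⊖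
(A ⊖) ~ = A ⊕

classical : Sign → Pure → Type
classical + A = A ⊕
classical - A = A ⊖

data Index : Set where
  one two : Index

select : ∀ {X : Set} → Index → X → X → X
select one x₁ x₂ = x₁
select two x₁ x₂ = x₂

-- Terms modulo α-renaming, as well-scoped de Bruijn terms: the elements of
-- Term n have their free variables among n given ones, and each binder adds
-- variable zero.
infix 5 _▶◀[_]_ _•[_]_

data Term (n : ℕ) : Set where
  var     : Fin n → Term n
  _▶◀[_]_ : Term n → Type → Term n → Term n
  pair    : Sign → Term n → Term n → Term n
  π       : Sign → Index → Term n → Term n
  inj     : Sign → Index → Term n → Term n
  -- δ σ t P s Q u  is  δ^σ t [x:P. s] [y:Q. u]
  δ       : Sign → Term n → Type → Term (suc n) → Type → Term (suc n) → Term n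
  ν       : Sign → Term n → Term n
  μ       : Sign → Term n → Term n
  IC      : Sign → Type → Term (suc n) → Term n
  _•[_]_  : Term n → Sign → Term n → Term n

ext : ∀ {m n} → (Fin m → Fin n) → Fin (suc m) → Fin (suc n)
ext ρ zero    = zero
ext ρ (suc x) = suc (ρ x)

rename : ∀ {m n} → (Fin m → Fin n) → Term m → Term n
rename ρ (var x)         = var (ρ x)
rename ρ (t ▶◀[ P ] s)   = rename ρ t ▶◀[ P ] rename ρ s
rename ρ (pair σ t s)    = pair σ (rename ρ t) (rename ρ s)
rename ρ (π σ i t)       = π σ i (rename ρ t)
rename ρ (inj σ i t)     = inj σ i (rename ρ t)
rename ρ (δ σ t P s Q u) = δ σ (rename ρ t) P (rename (ext ρ) s) Q (rename (ext ρ) u)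
rename ρ (ν σ t)         = ν σ (rename ρ t)
rename ρ (μ σ t)         = μ σ (rename ρ t)
rename ρ (IC σ P t)      = IC σ P (rename (ext ρ) t)
rename ρ (t •[ σ ] s)    = rename ρ t •[ σ ] rename ρ s

exts : ∀ {m n} → (Fin m → Term n) → Fin (suc m) → Term (suc n)
exts θ zero    = var zero
exts θ (suc x) = rename suc (θ x)

subst : ∀ {m n} → (Fin m → Term n) → Term m → Term n
subst θ (var x)         = θ x
subst θ (t ▶◀[ P ] s)   = subst θ t ▶◀[ P ] subst θ s
subst θ (pair σ t s)    = pair σ (subst θ t) (subst θ s)
subst θ (π σ i t)       = π σ i (subst θ t)
subst θ (inj σ i t)     = inj σ i (subst θ t)
subst θ (δ σ t P s Q u) = δ σ (subst θ t) P (subst (exts θ) s) Q (subst (exts θ) u)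
subst θ (ν σ t)         = ν σ (subst θ t)
subst θ (μ σ t)         = μ σ (subst θ t)
subst θ (IC σ P t)      = IC σ P (subst (exts θ) t)
subst θ (t •[ σ ] s)    = subst θ t •[ σ ] subst θ s

single : ∀ {n} → Term n → Fin (suc n) → Term n
single s zero    = s
single s (suc x) = var x

infix 8 _[_]

-- t [ s ]  is  t[x:=s]  for x the variable zero of t.
_[_] : ∀ {n} → Term (suc n) → Term n → Term n
t [ s ] = subst (single s) t

Context : ℕ → Set
Context n = Vec Type n

infix 3 _⊢_∶_

data _⊢_∶_ {n : ℕ} (Γ : Context n) : Term n → Type → Set where
  ax  : ∀ x → Γ ⊢ var x ∶ lookup Γ x

  abs : ∀ {t s P Q} → Strong P →
        Γ ⊢ t ∶ P → Γ ⊢ s ∶ P ~ → Γ ⊢ t ▶◀[ Q ] s ∶ Q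

  I∧⁺ : ∀ {t s A B} →
        Γ ⊢ t ∶ A ⊕ → Γ ⊢ s ∶ B ⊕ → Γ ⊢ pair + t s ∶ (A ∧ B) ⁺
  I∨⁻ : ∀ {t s A B} →
        Γ ⊢ t ∶ A ⊖ → Γ ⊢ s ∶ B ⊖ → Γ ⊢ pair - t s ∶ (A ∨ B) ⁻

  E∧⁺ : ∀ {t A₁ A₂} i →
        Γ ⊢ t ∶ (A₁ ∧ A₂) ⁺ → Γ ⊢ π + i t ∶ select i A₁ A₂ ⊕
  E∨⁻ : ∀ {t A₁ A₂} i →
        Γ ⊢ t ∶ (A₁ ∨ A₂) ⁻ → Γ ⊢ π - i t ∶ select i A₁ A₂ ⊖

  I∨⁺ : ∀ {t A₁ A₂} i →
        Γ ⊢ t ∶ select i A₁ A₂ ⊕ → Γ ⊢ inj + i t ∶ (A₁ ∨ A₂) ⁺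
  I∧⁻ : ∀ {t A₁ A₂} i →
        Γ ⊢ t ∶ select i A₁ A₂ ⊖ → Γ ⊢ inj - i t ∶ (A₁ ∧ A₂) ⁻

  E∨⁺ : ∀ {t s u A B P} →
        Γ ⊢ t ∶ (A ∨ B) ⁺ →
        (A ⊕) ∷ Γ ⊢ s ∶ P → (B ⊕) ∷ Γ ⊢ u ∶ P →
        Γ ⊢ δ + t (A ⊕) s (B ⊕) u ∶ P
  E∧⁻ : ∀ {t s u A B P} →
        Γ ⊢ t ∶ (A ∧ B) ⁻ →
        (A ⊖) ∷ Γ ⊢ s ∶ P → (B ⊖) ∷ Γ ⊢ u ∶ P →
        Γ ⊢ δ - t (A ⊖) s (B ⊖) u ∶ P

  I¬⁺ : ∀ {t A} → Γ ⊢ t ∶ A ⊖ → Γ ⊢ ν + t ∶ (neg A) ⁺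
  I¬⁻ : ∀ {t A} → Γ ⊢ t ∶ A ⊕ → Γ ⊢ ν - t ∶ (neg A) ⁻

  E¬⁺ : ∀ {t A} → Γ ⊢ t ∶ (neg A) ⁺ → Γ ⊢ μ + t ∶ A ⊖
  E¬⁻ : ∀ {t A} → Γ ⊢ t ∶ (neg A) ⁻ → Γ ⊢ μ - t ∶ A ⊕

  IC⁺ : ∀ {t A} → (A ⊖) ∷ Γ ⊢ t ∶ A ⁺ → Γ ⊢ IC + (A ⊖) t ∶ A ⊕
  IC⁻ : ∀ {t A} → (A ⊕) ∷ Γ ⊢ t ∶ A ⁻ → Γ ⊢ IC - (A ⊕) t ∶ A ⊖

  EC⁺ : ∀ {t s A} → Γ ⊢ t ∶ A ⊕ → Γ ⊢ s ∶ A ⊖ → Γ ⊢ t •[ + ] s ∶ A ⁺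
  EC⁻ : ∀ {t s A} → Γ ⊢ t ∶ A ⊖ → Γ ⊢ s ∶ A ⊕ → Γ ⊢ t •[ - ] s ∶ A ⁻

Typable : ∀ {n} → Term n → Set
Typable {n} t = ∃[ Γ ] ∃[ P ] (Γ ⊢ t ∶ P)

infix 5 _⋈[_,_]_

-- t ⋈[ P , Q ] s  is the generalized absurdity  t ⋈_Q s  for t : P and s : P ~.
_⋈[_,_]_ : ∀ {n} → Term n → Type → Type → Term n → Term n
t ⋈[ A ⁺ , Q ] s = t ▶◀[ Q ] s
t ⋈[ A ⁻ , Q ] s = t ▶◀[ Q ] s
t ⋈[ A ⊕ , Q ] s = (t •[ + ] s) ▶◀[ Q ] (s •[ - ] t)
t ⋈[ A ⊖ , Q ] s = (t •[ - ] s) ▶◀[ Q ] (s •[ + ] t)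

infix 4 _⟶_

-- The relation is given on all raw terms; reducts of typable terms are again
-- typable.  In the last three β-rules, the typing rules force the left operand
-- of ⋈ to have type  classical σ A  (for ν,  classical (opposite σ) A)  for
-- some A whenever the redex is typable, and ⋈ does not depend on that A.
data _⟶_ {n : ℕ} : Term n → Term n → Set where
  β-π     : ∀ {σ i t₁ t₂} →
            π σ i (pair σ t₁ t₂) ⟶ select i t₁ t₂
  β-δ     : ∀ {σ i t P₁ s₁ P₂ s₂} →
            δ σ (inj σ i t) P₁ s₁ P₂ s₂ ⟶ select i s₁ s₂ [ t ]
  β-μ     : ∀ {σ t} →
            μ σ (ν σ t) ⟶ t
  β-•     : ∀ {σ P t s} →
            IC σ P t •[ σ ] s ⟶ t [ s ]
  β-pair  : ∀ {σ i t₁ t₂ s Q} A →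
            pair σ t₁ t₂ ▶◀[ Q ] inj (opposite σ) i s
              ⟶ select i t₁ t₂ ⋈[ classical σ A , Q ] s
  β-inj   : ∀ {σ i t s₁ s₂ Q} A →
            inj σ i t ▶◀[ Q ] pair (opposite σ) s₁ s₂
              ⟶ t ⋈[ classical σ A , Q ] select i s₁ s₂
  β-ν     : ∀ {σ t s Q} A →
            ν σ t ▶◀[ Q ] ν (opposite σ) s
              ⟶ t ⋈[ classical (opposite σ) A , Q ] s

  ξ-▶◀₁   : ∀ {t t′ s Q} → t ⟶ t′ → t ▶◀[ Q ] s ⟶ t′ ▶◀[ Q ] s
  ξ-▶◀₂   : ∀ {t s s′ Q} → s ⟶ s′ → t ▶◀[ Q ] s ⟶ t ▶◀[ Q ] s′
  ξ-pair₁ : ∀ {σ t t′ s} → t ⟶ t′ → pair σ t s ⟶ pair σ t′ s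
  ξ-pair₂ : ∀ {σ t s s′} → s ⟶ s′ → pair σ t s ⟶ pair σ t s′
  ξ-π     : ∀ {σ i t t′} → t ⟶ t′ → π σ i t ⟶ π σ i t′
  ξ-inj   : ∀ {σ i t t′} → t ⟶ t′ → inj σ i t ⟶ inj σ i t′
  ξ-δ₁    : ∀ {σ t t′ P s Q u} → t ⟶ t′ → δ σ t P s Q u ⟶ δ σ t′ P s Q u
  ξ-δ₂    : ∀ {σ t P s s′ Q u} → s ⟶ s′ → δ σ t P s Q u ⟶ δ σ t P s′ Q u
  ξ-δ₃    : ∀ {σ t P s Q u u′} → u ⟶ u′ → δ σ t P s Q u ⟶ δ σ t P s Q u′
  ξ-ν     : ∀ {σ t t′} → t ⟶ t′ → ν σ t ⟶ ν σ t′
  ξ-μ     : ∀ {σ t t′} → t ⟶ t′ → μ σ t ⟶ μ σ t′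
  ξ-IC    : ∀ {σ P t t′} → t ⟶ t′ → IC σ P t ⟶ IC σ P t′
  ξ-•₁    : ∀ {σ t t′ s} → t ⟶ t′ → t •[ σ ] s ⟶ t′ •[ σ ] s
  ξ-•₂    : ∀ {σ t s s′} → s ⟶ s′ → t •[ σ ] s ⟶ t •[ σ ] s′

{-# OPTIONS --safe #-}
-- Strong normalization is proved by substitution into an inductively defined set SN of typed
-- terms, by induction on the pure proposition A of the substituted variable.  The rule split of SN
-- replaces commuting conversions: E[δ n s u] with n neutral is in SN if E[s] and E[u] are.
--
-- The only difficulty is that A ⊕ and A ⊖ are mutually recursive, A ⊕ = A ⊖ → A ⁺ and
-- A ⊖ = A ⊕ → A ⁻.  No fixed point is needed, as finite approximations suffice: let Y₀ = SN,
-- X_i = Y_i → SN and Y_{i+1} = X_i → SN, so that X_i increases and Y_i decreases.  If t is in SN,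
-- then for every i there is a k such that substituting elements of X_i for variables of type A ⊕
-- and elements of Y_k for variables of type A ⊖ leaves t in SN; moreover it maps t to X_j for some
-- j if t : A ⊕, and, for every j, to Y_j with a suitable k if t : A ⊖.

module Submission where

open import Defs
open import Data.Empty using (⊥; ⊥-elim)
open import Data.Fin using (Fin; zero; suc)
open import Data.List using (List; []; _∷_; _++_; map; foldr)
open import Data.List.Properties using (map-++; map-∘; map-cong; map-id; foldr-++)
open import Data.Nat using (ℕ; zero; suc; _≤_; z≤n; s≤s; _⊔_)
open import Data.Nat.Properties using (≤-refl; m≤m⊔n; m≤n⊔m)
open import Data.Product using (_×_; _,_; proj₁; proj₂; ∃-syntax; Σ-syntax)
open import Data.Sign using (Sign; +; -; opposite)
open import Data.Sum using (_⊎_; inj₁; inj₂)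
open import Data.Unit using (⊤)
open import Data.Vec using (Vec; []; _∷_; lookup)
import Data.Vec as Vec
open import Data.Vec.Properties using (lookup-map)
open import Data.Vec.Relation.Unary.All using (All; _∷_; universal)
open import Data.Vec.Relation.Unary.All.Properties using (lookup⁺)
open import Function using (_∘_; id)
open import Induction.WellFounded using (Acc; acc; acc-inverse)
open import Relation.Binary.Construct.Closure.ReflexiveTransitive using (Star; ε; _◅_; _◅◅_; gmap)
open import Relation.Binary.PropositionalEquality as ≡ using (_≡_; refl; sym; trans; cong; cong₂)
open import Relation.Nullary using (¬_)

-- Contracting a `•`-redex at A ⊕ substitutes a term of type A ⊖, which may itself be an abstraction
-- over A ⊕. The type need not shrink, so induction on A alone does not settle this case. What is
-- finite is the derivation: an occurrence of a substituted variable of type A ⊖ applied to s only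
-- demands that its substitute tolerate the level reached by s, and the maximum of finitely many
-- demands is a sufficient k. A variable of type A ⊕ instead asks its argument for the level i,
-- which must therefore be known beforehand. Hence the order of the quantifiers over i and k.
--
-- After one application the type is A ⁺ or A ⁻, whose projections, case distinctions and `μ` only
-- reach components of A, where the induction hypothesis applies. Absurdity can return to any type,
-- but it never produces a value; the shape `neutral` records this.
--
-- Splits are needed even though the calculus has no commuting conversions: a substitution can turn
-- the scrutinee into an injection, and then the branch meets the surrounding context at a type
-- unrelated to A.

private variable
  l m n  : ℕ
  i      : Index
  σ      : Sign
  t t′ u s r r′ d : Term n
  Q R    : Type

-- Substitution

cong₃ : ∀ {A B C D : Set} (f : A → B → C → D) {a a′ b b′ c c′} →
        a ≡ a′ → b ≡ b′ → c ≡ c′ → f a b c ≡ f a′ b′ c′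
cong₃ f refl refl refl = refl

-- As in the laws below, the pointwise hypothesis replaces function extensionality; the companion
-- with suffix `-exts` carries it under a binder.
rename-as-subst : {ρ : Fin m → Fin n} {θ : Fin m → Term n} →
                  (∀ x → θ x ≡ var (ρ x)) → ∀ t → rename ρ t ≡ subst θ t
rename-as-subst-exts : {ρ : Fin m → Fin n} {θ : Fin m → Term n} →
                       (∀ x → θ x ≡ var (ρ x)) → ∀ x → exts θ x ≡ var (ext ρ x)
rename-as-subst-exts e zero    = refl
rename-as-subst-exts e (suc x) = cong (rename suc) (e x)
rename-as-subst e (var x)         = sym (e x)
rename-as-subst e (t ▶◀[ P ] s)   = cong₂ (_▶◀[ P ]_) (rename-as-subst e t) (rename-as-subst e s)
rename-as-subst e (pair σ t s)    = cong₂ (pair σ) (rename-as-subst e t) (rename-as-subst e s)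
rename-as-subst e (π σ i t)       = cong (π σ i) (rename-as-subst e t)
rename-as-subst e (inj σ i t)     = cong (inj σ i) (rename-as-subst e t)
rename-as-subst e (δ σ t P s Q u) = cong₃ (λ t s u → δ σ t P s Q u) (rename-as-subst e t)
  (rename-as-subst (rename-as-subst-exts e) s) (rename-as-subst (rename-as-subst-exts e) u)
rename-as-subst e (ν σ t)         = cong (ν σ) (rename-as-subst e t)
rename-as-subst e (μ σ t)         = cong (μ σ) (rename-as-subst e t)
rename-as-subst e (IC σ P t)      = cong (IC σ P) (rename-as-subst (rename-as-subst-exts e) t)
rename-as-subst e (t •[ σ ] s)    = cong₂ (_•[ σ ]_) (rename-as-subst e t) (rename-as-subst e s)

subst-rename : {ρ : Fin l → Fin m} {θ : Fin m → Term n} {θ′ : Fin l → Term n} →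
               (∀ x → θ (ρ x) ≡ θ′ x) → ∀ t → subst θ (rename ρ t) ≡ subst θ′ t
subst-rename-exts : {ρ : Fin l → Fin m} {θ : Fin m → Term n} {θ′ : Fin l → Term n} →
                    (∀ x → θ (ρ x) ≡ θ′ x) → ∀ x → exts θ (ext ρ x) ≡ exts θ′ x
subst-rename-exts e zero    = refl
subst-rename-exts e (suc x) = cong (rename suc) (e x)
subst-rename e (var x)         = e x
subst-rename e (t ▶◀[ P ] s)   = cong₂ (_▶◀[ P ]_) (subst-rename e t) (subst-rename e s)
subst-rename e (pair σ t s)    = cong₂ (pair σ) (subst-rename e t) (subst-rename e s)
subst-rename e (π σ i t)       = cong (π σ i) (subst-rename e t)
subst-rename e (inj σ i t)     = cong (inj σ i) (subst-rename e t)
subst-rename e (δ σ t P s Q u) = cong₃ (λ t s u → δ σ t P s Q u) (subst-rename e t)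
  (subst-rename (subst-rename-exts e) s) (subst-rename (subst-rename-exts e) u)
subst-rename e (ν σ t)         = cong (ν σ) (subst-rename e t)
subst-rename e (μ σ t)         = cong (μ σ) (subst-rename e t)
subst-rename e (IC σ P t)      = cong (IC σ P) (subst-rename (subst-rename-exts e) t)
subst-rename e (t •[ σ ] s)    = cong₂ (_•[ σ ]_) (subst-rename e t) (subst-rename e s)

rename-rename : {ρ : Fin l → Fin m} {ρ′ : Fin m → Fin n} {ρ″ : Fin l → Fin n} →
                (∀ x → ρ′ (ρ x) ≡ ρ″ x) → ∀ t → rename ρ′ (rename ρ t) ≡ rename ρ″ t
rename-rename {ρ′ = ρ′} {ρ″} e t =
  trans (rename-as-subst {θ = var ∘ ρ′} (λ _ → refl) (rename _ t))
    (trans (subst-rename {θ′ = var ∘ ρ″} (cong var ∘ e) t) (sym (rename-as-subst (λ _ → refl) t)))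

rename-subst : {θ : Fin l → Term m} {ρ : Fin m → Fin n} {θ′ : Fin l → Term n} →
               (∀ x → rename ρ (θ x) ≡ θ′ x) → ∀ t → rename ρ (subst θ t) ≡ subst θ′ t
rename-subst-exts : {θ : Fin l → Term m} {ρ : Fin m → Fin n} {θ′ : Fin l → Term n} →
                    (∀ x → rename ρ (θ x) ≡ θ′ x) → ∀ x → rename (ext ρ) (exts θ x) ≡ exts θ′ x
rename-subst-exts e zero    = refl
rename-subst-exts {θ = θ} e (suc x) =
  trans (rename-rename (λ _ → refl) (θ x))
    (trans (sym (rename-rename (λ _ → refl) (θ x))) (cong (rename suc) (e x)))
rename-subst e (var x)         = e x
rename-subst e (t ▶◀[ P ] s)   = cong₂ (_▶◀[ P ]_) (rename-subst e t) (rename-subst e s)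
rename-subst e (pair σ t s)    = cong₂ (pair σ) (rename-subst e t) (rename-subst e s)
rename-subst e (π σ i t)       = cong (π σ i) (rename-subst e t)
rename-subst e (inj σ i t)     = cong (inj σ i) (rename-subst e t)
rename-subst e (δ σ t P s Q u) = cong₃ (λ t s u → δ σ t P s Q u) (rename-subst e t)
  (rename-subst (rename-subst-exts e) s) (rename-subst (rename-subst-exts e) u)
rename-subst e (ν σ t)         = cong (ν σ) (rename-subst e t)
rename-subst e (μ σ t)         = cong (μ σ) (rename-subst e t)
rename-subst e (IC σ P t)      = cong (IC σ P) (rename-subst (rename-subst-exts e) t)
rename-subst e (t •[ σ ] s)    = cong₂ (_•[ σ ]_) (rename-subst e t) (rename-subst e s)

subst-subst : {θ : Fin l → Term m} {θ′ : Fin m → Term n} {θ″ : Fin l → Term n} →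
              (∀ x → subst θ′ (θ x) ≡ θ″ x) → ∀ t → subst θ′ (subst θ t) ≡ subst θ″ t
subst-subst-exts : {θ : Fin l → Term m} {θ′ : Fin m → Term n} {θ″ : Fin l → Term n} →
                   (∀ x → subst θ′ (θ x) ≡ θ″ x) → ∀ x → subst (exts θ′) (exts θ x) ≡ exts θ″ x
subst-subst-exts e zero    = refl
subst-subst-exts {θ = θ} e (suc x) =
  trans (subst-rename (λ _ → refl) (θ x))
    (trans (sym (rename-subst (λ _ → refl) (θ x))) (cong (rename suc) (e x)))
subst-subst e (var x)         = e x
subst-subst e (t ▶◀[ P ] s)   = cong₂ (_▶◀[ P ]_) (subst-subst e t) (subst-subst e s)
subst-subst e (pair σ t s)    = cong₂ (pair σ) (subst-subst e t) (subst-subst e s)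
subst-subst e (π σ i t)       = cong (π σ i) (subst-subst e t)
subst-subst e (inj σ i t)     = cong (inj σ i) (subst-subst e t)
subst-subst e (δ σ t P s Q u) = cong₃ (λ t s u → δ σ t P s Q u) (subst-subst e t)
  (subst-subst (subst-subst-exts e) s) (subst-subst (subst-subst-exts e) u)
subst-subst e (ν σ t)         = cong (ν σ) (subst-subst e t)
subst-subst e (μ σ t)         = cong (μ σ) (subst-subst e t)
subst-subst e (IC σ P t)      = cong (IC σ P) (subst-subst (subst-subst-exts e) t)
subst-subst e (t •[ σ ] s)    = cong₂ (_•[ σ ]_) (subst-subst e t) (subst-subst e s)

subst-var : ∀ (t : Term n) → subst var t ≡ t
rename-id : {ρ : Fin n → Fin n} → (∀ x → ρ x ≡ x) → ∀ t → rename ρ t ≡ t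
rename-id-ext : {ρ : Fin n → Fin n} → (∀ x → ρ x ≡ x) → ∀ x → ext ρ x ≡ x
rename-id-ext e zero    = refl
rename-id-ext e (suc x) = cong suc (e x)
rename-id e (var x)         = cong var (e x)
rename-id e (t ▶◀[ P ] s)   = cong₂ (_▶◀[ P ]_) (rename-id e t) (rename-id e s)
rename-id e (pair σ t s)    = cong₂ (pair σ) (rename-id e t) (rename-id e s)
rename-id e (π σ i t)       = cong (π σ i) (rename-id e t)
rename-id e (inj σ i t)     = cong (inj σ i) (rename-id e t)
rename-id e (δ σ t P s Q u) = cong₃ (λ t s u → δ σ t P s Q u) (rename-id e t)
  (rename-id (rename-id-ext e) s) (rename-id (rename-id-ext e) u)
rename-id e (ν σ t)         = cong (ν σ) (rename-id e t)
rename-id e (μ σ t)         = cong (μ σ) (rename-id e t)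
rename-id e (IC σ P t)      = cong (IC σ P) (rename-id (rename-id-ext e) t)
rename-id e (t •[ σ ] s)    = cong₂ (_•[ σ ]_) (rename-id e t) (rename-id e s)
subst-var t = trans (sym (rename-as-subst (λ _ → refl) t)) (rename-id (λ _ → refl) t)

-- Fusion with the identity renaming spares another induction on the term.
subst-cong : {θ θ′ : Fin m → Term n} → (∀ x → θ x ≡ θ′ x) → ∀ t → subst θ t ≡ subst θ′ t
subst-cong e t = trans (cong (subst _) (sym (rename-id (λ _ → refl) t))) (subst-rename {ρ = id} e t)

infixl 6 _▹_

_▹_ : (Fin m → Term n) → Term n → Fin (suc m) → Term n
(θ ▹ s) zero    = s
(θ ▹ s) (suc x) = θ x

exts-single : ∀ (θ : Fin m → Term n) t s → subst (exts θ) t [ s ] ≡ subst (θ ▹ s) t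
exts-single θ t s = subst-subst eq t
  where
  eq : ∀ x → subst (single s) (exts θ x) ≡ (θ ▹ s) x
  eq zero    = refl
  eq (suc x) = trans (subst-rename (λ _ → refl) (θ x)) (subst-var (θ x))

subst-[] : ∀ (θ : Fin m → Term n) t s → subst θ (t [ s ]) ≡ subst (exts θ) t [ subst θ s ]
subst-[] θ t s = trans (subst-subst eq t) (sym (exts-single θ t (subst θ s)))
  where
  eq : ∀ x → subst θ (single s x) ≡ (θ ▹ subst θ s) x
  eq zero    = refl
  eq (suc x) = refl

rename-[] : ∀ (ρ : Fin m → Fin n) t s → rename ρ (t [ s ]) ≡ rename (ext ρ) t [ rename ρ s ]
rename-[] ρ t s = trans (rename-subst {θ′ = single (rename ρ s) ∘ ext ρ} eq t)
                        (sym (subst-rename (λ _ → refl) t))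
  where
  eq : ∀ x → rename ρ (single s x) ≡ single (rename ρ s) (ext ρ x)
  eq zero    = refl
  eq (suc x) = refl

subst-select : ∀ (θ : Fin m → Term n) i t u →
               subst θ (select i t u) ≡ select i (subst θ t) (subst θ u)
subst-select θ one t u = refl
subst-select θ two t u = refl

rename-select : ∀ (ρ : Fin m → Fin n) i t u →
                rename ρ (select i t u) ≡ select i (rename ρ t) (rename ρ u)
rename-select ρ one t u = refl
rename-select ρ two t u = refl

-- Evaluation contexts

-- Both operands of an absurdity are evaluation positions, because its β-rules inspect both of them.
data Frame (n : ℕ) : Set where
  _•ᶠ_  : Sign → Term n → Frame n
  πᶠ    : Sign → Index → Frame n
  μᶠ    : Sign → Frame n
  δᶠ    : Sign → Type → Term (suc n) → Type → Term (suc n) → Frame n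
  _▶◀ᶠ_ : Type → Term n → Frame n
  ▶◀ᶠ′  : Type → Term n → Frame n

plugᶠ : Frame n → Term n → Term n
plugᶠ (σ •ᶠ s)         t = t •[ σ ] s
plugᶠ (πᶠ σ i)         t = π σ i t
plugᶠ (μᶠ σ)           t = μ σ t
plugᶠ (δᶠ σ P s Q u)   t = δ σ t P s Q u
plugᶠ (Q ▶◀ᶠ s)        t = t ▶◀[ Q ] s
plugᶠ (▶◀ᶠ′ Q s)       t = s ▶◀[ Q ] t

substᶠ : (Fin m → Term n) → Frame m → Frame n
substᶠ θ (σ •ᶠ s)       = σ •ᶠ subst θ s
substᶠ θ (πᶠ σ i)       = πᶠ σ i
substᶠ θ (μᶠ σ)         = μᶠ σ
substᶠ θ (δᶠ σ P s Q u) = δᶠ σ P (subst (exts θ) s) Q (subst (exts θ) u)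
substᶠ θ (Q ▶◀ᶠ s)      = Q ▶◀ᶠ subst θ s
substᶠ θ (▶◀ᶠ′ Q s)     = ▶◀ᶠ′ Q (subst θ s)

-- The outermost frame comes first.
Frames : ℕ → Set
Frames n = List (Frame n)

plug : Frames n → Term n → Term n
plug K t = foldr plugᶠ t K

substᴷ : (Fin m → Term n) → Frames m → Frames n
substᴷ θ = map (substᶠ θ)

shift : Fin n → Term (suc n)
shift = var ∘ suc

infix 9 _↑

_↑ : Frames n → Frames (suc n)
_↑ = substᴷ shift

plug-++ : ∀ (K L : Frames n) t → plug (K ++ L) t ≡ plug K (plug L t)
plug-++ K L t = foldr-++ plugᶠ t K L

subst-plug : ∀ (θ : Fin m → Term n) K t → subst θ (plug K t) ≡ plug (substᴷ θ K) (subst θ t)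
subst-plug θ []                   t = refl
subst-plug θ ((σ •ᶠ s) ∷ K)       t = cong (_•[ σ ] subst θ s) (subst-plug θ K t)
subst-plug θ (πᶠ σ i ∷ K)         t = cong (π σ i) (subst-plug θ K t)
subst-plug θ (μᶠ σ ∷ K)           t = cong (μ σ) (subst-plug θ K t)
subst-plug θ (δᶠ σ P s Q u ∷ K)   t = cong (λ t → δ σ t P _ Q _) (subst-plug θ K t)
subst-plug θ ((Q ▶◀ᶠ s) ∷ K)      t = cong (_▶◀[ Q ] subst θ s) (subst-plug θ K t)
subst-plug θ (▶◀ᶠ′ Q s ∷ K)       t = cong (subst θ s ▶◀[ Q ]_) (subst-plug θ K t)

rename-plug : ∀ (ρ : Fin m → Fin n) K t →
              rename ρ (plug K t) ≡ plug (substᴷ (var ∘ ρ) K) (rename ρ t)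
rename-plug ρ K t = trans (rename-as-subst (λ _ → refl) (plug K t))
  (trans (subst-plug (var ∘ ρ) K t)
         (cong (plug (substᴷ (var ∘ ρ) K)) (sym (rename-as-subst (λ _ → refl) t))))

substᶠ-substᶠ : {θ : Fin l → Term m} {θ′ : Fin m → Term n} {θ″ : Fin l → Term n} →
                (∀ x → subst θ′ (θ x) ≡ θ″ x) → ∀ f → substᶠ θ′ (substᶠ θ f) ≡ substᶠ θ″ f
substᶠ-substᶠ e (σ •ᶠ s)       = cong (σ •ᶠ_) (subst-subst e s)
substᶠ-substᶠ e (πᶠ σ i)       = refl
substᶠ-substᶠ e (μᶠ σ)         = refl
substᶠ-substᶠ e (δᶠ σ P s Q u) = cong₂ (λ s u → δᶠ σ P s Q u)
  (subst-subst (subst-subst-exts e) s) (subst-subst (subst-subst-exts e) u)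
substᶠ-substᶠ e (Q ▶◀ᶠ s)      = cong (Q ▶◀ᶠ_) (subst-subst e s)
substᶠ-substᶠ e (▶◀ᶠ′ Q s)     = cong (▶◀ᶠ′ Q) (subst-subst e s)

substᴷ-substᴷ : {θ : Fin l → Term m} {θ′ : Fin m → Term n} {θ″ : Fin l → Term n} →
                (∀ x → subst θ′ (θ x) ≡ θ″ x) → ∀ K → substᴷ θ′ (substᴷ θ K) ≡ substᴷ θ″ K
substᴷ-substᴷ e K = trans (sym (map-∘ K)) (map-cong (substᶠ-substᶠ e) K)

substᶠ-var : ∀ (f : Frame n) → substᶠ var f ≡ f
substᶠ-var (σ •ᶠ s)       = cong (σ •ᶠ_) (subst-var s)
substᶠ-var (πᶠ σ i)       = refl
substᶠ-var (μᶠ σ)         = refl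
substᶠ-var (δᶠ σ P s Q u) = cong₂ (λ s u → δᶠ σ P s Q u) (exts-var s) (exts-var u)
  where
  exts-var : ∀ t → subst (exts var) t ≡ t
  exts-var t = trans (subst-cong (λ { zero → refl ; (suc x) → refl }) t) (subst-var t)
substᶠ-var (Q ▶◀ᶠ s)      = cong (Q ▶◀ᶠ_) (subst-var s)
substᶠ-var (▶◀ᶠ′ Q s)     = cong (▶◀ᶠ′ Q) (subst-var s)

plug-[] : ∀ (K : Frames n) t s → plug (K ↑) t [ s ] ≡ plug K (t [ s ])
plug-[] K t s = trans (subst-plug (single s) (K ↑) t) (cong (λ K → plug K (t [ s ])) eq)
  where
  eq : substᴷ (single s) (K ↑) ≡ K
  eq = trans (substᴷ-substᴷ {θ″ = var} (λ _ → refl) K) (trans (map-cong substᶠ-var K) (map-id K))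

↑-subst : ∀ (θ : Fin m → Term n) K → substᴷ (exts θ) (K ↑) ≡ substᴷ θ K ↑
↑-subst θ K = trans (substᴷ-substᴷ (λ _ → refl) K)
                    (sym (substᴷ-substᴷ (λ x → sym (rename-as-subst (λ _ → refl) (θ x))) K))

subst-plug-↑ : ∀ (θ : Fin m → Term n) K t →
               subst (exts θ) (plug (K ↑) t) ≡ plug (substᴷ θ K ↑) (subst (exts θ) t)
subst-plug-↑ θ K t = trans (subst-plug (exts θ) (K ↑) t) (cong (λ K → plug K (subst (exts θ) t)) (↑-subst θ K))

exts-ext : ∀ (ρ : Fin m → Fin n) x → exts (var ∘ ρ) x ≡ var (ext ρ x)
exts-ext ρ zero    = refl
exts-ext ρ (suc x) = refl

rename-ext : ∀ (ρ : Fin m → Fin n) t → rename (ext ρ) t ≡ subst (exts (var ∘ ρ)) t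
rename-ext ρ = rename-as-subst (exts-ext ρ)

rename-plug-↑ : ∀ (ρ : Fin m → Fin n) K t →
                rename (ext ρ) (plug (K ↑) t) ≡ plug (substᴷ (var ∘ ρ) K ↑) (rename (ext ρ) t)
rename-plug-↑ ρ K t = trans (rename-ext ρ (plug (K ↑) t))
  (trans (subst-plug-↑ (var ∘ ρ) K t) (cong (plug (substᴷ (var ∘ ρ) K ↑)) (sym (rename-ext ρ t))))

-- Reduction and strong normalization of raw terms

cut : Sign → Type → Term n → Term n → Term n
cut σ Q t s = (t •[ σ ] s) ▶◀[ Q ] (s •[ opposite σ ] t)

⋈-classical : ∀ σ A (t : Term n) → t ⋈[ classical σ A , Q ] s ≡ cut σ Q t s
⋈-classical + A t = refl
⋈-classical - A t = refl

⋈-classical-opposite : ∀ σ A (t : Term n) →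
  t ⋈[ classical (opposite σ) A , Q ] s ≡ (t •[ opposite σ ] s) ▶◀[ Q ] (s •[ σ ] t)
⋈-classical-opposite + A t = refl
⋈-classical-opposite - A t = refl

subst-⋈ : ∀ (θ : Fin m → Term n) σ A t s →
          subst θ (t ⋈[ classical σ A , Q ] s) ≡ subst θ t ⋈[ classical σ A , Q ] subst θ s
subst-⋈ θ + A t s = refl
subst-⋈ θ - A t s = refl

step-≡ : t ⟶ t′ → u ≡ t′ → t ⟶ u
step-≡ st refl = st

step-subst : ∀ (θ : Fin m → Term n) → t ⟶ t′ → subst θ t ⟶ subst θ t′
step-subst θ (β-π {i = one})              = β-π
step-subst θ (β-π {i = two})              = β-π
step-subst θ (β-δ {i = one} {t} {s₁ = s}) = step-≡ (β-δ {i = one}) (subst-[] θ s t)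
step-subst θ (β-δ {i = two} {t} {s₂ = s}) = step-≡ (β-δ {i = two}) (subst-[] θ s t)
step-subst θ β-μ                          = β-μ
step-subst θ (β-• {t = t} {s})            = step-≡ β-• (subst-[] θ t s)
step-subst θ (β-pair {σ = σ} {i = one} A) = step-≡ (β-pair A) (subst-⋈ θ σ A _ _)
step-subst θ (β-pair {σ = σ} {i = two} A) = step-≡ (β-pair A) (subst-⋈ θ σ A _ _)
step-subst θ (β-inj {σ = σ} {i = one} A)  = step-≡ (β-inj A) (subst-⋈ θ σ A _ _)
step-subst θ (β-inj {σ = σ} {i = two} A)  = step-≡ (β-inj A) (subst-⋈ θ σ A _ _)
step-subst θ (β-ν {σ = σ} A)              = step-≡ (β-ν A) (subst-⋈ θ (opposite σ) A _ _)
step-subst θ (ξ-▶◀₁ st)   = ξ-▶◀₁ (step-subst θ st)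
step-subst θ (ξ-▶◀₂ st)   = ξ-▶◀₂ (step-subst θ st)
step-subst θ (ξ-pair₁ st) = ξ-pair₁ (step-subst θ st)
step-subst θ (ξ-pair₂ st) = ξ-pair₂ (step-subst θ st)
step-subst θ (ξ-π st)     = ξ-π (step-subst θ st)
step-subst θ (ξ-inj st)   = ξ-inj (step-subst θ st)
step-subst θ (ξ-δ₁ st)    = ξ-δ₁ (step-subst θ st)
step-subst θ (ξ-δ₂ st)    = ξ-δ₂ (step-subst (exts θ) st)
step-subst θ (ξ-δ₃ st)    = ξ-δ₃ (step-subst (exts θ) st)
step-subst θ (ξ-ν st)     = ξ-ν (step-subst θ st)
step-subst θ (ξ-μ st)     = ξ-μ (step-subst θ st)
step-subst θ (ξ-IC st)    = ξ-IC (step-subst (exts θ) st)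
step-subst θ (ξ-•₁ st)    = ξ-•₁ (step-subst θ st)
step-subst θ (ξ-•₂ st)    = ξ-•₂ (step-subst θ st)

infix 4 _⟶*_

_⟶*_ : Term n → Term n → Set
_⟶*_ = Star _⟶_

steps-rename : ∀ (ρ : Fin m → Fin n) → t ⟶* t′ → rename ρ t ⟶* rename ρ t′
steps-rename ρ = gmap (rename ρ) λ {t} {t′} st →
  ≡.subst₂ _⟶_ (sym (rename-as-subst (λ _ → refl) t)) (sym (rename-as-subst (λ _ → refl) t′))
    (step-subst (var ∘ ρ) st)

steps-subst : ∀ {θ θ′ : Fin m → Term n} → (∀ x → θ x ⟶* θ′ x) → ∀ t → subst θ t ⟶* subst θ′ t
steps-exts : ∀ {θ θ′ : Fin m → Term n} → (∀ x → θ x ⟶* θ′ x) → ∀ x → exts θ x ⟶* exts θ′ x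
steps-exts e zero    = ε
steps-exts e (suc x) = steps-rename suc (e x)
steps-subst e (var x)         = e x
steps-subst e (t ▶◀[ P ] s)   =
  gmap (_▶◀[ P ] _) ξ-▶◀₁ (steps-subst e t) ◅◅ gmap (_ ▶◀[ P ]_) ξ-▶◀₂ (steps-subst e s)
steps-subst e (pair σ t s)    =
  gmap (λ t → pair σ t _) ξ-pair₁ (steps-subst e t) ◅◅ gmap (pair σ _) ξ-pair₂ (steps-subst e s)
steps-subst e (π σ i t)       = gmap (π σ i) ξ-π (steps-subst e t)
steps-subst e (inj σ i t)     = gmap (inj σ i) ξ-inj (steps-subst e t)
steps-subst e (δ σ t P s Q u) =
  gmap (λ t → δ σ t P _ Q _) ξ-δ₁ (steps-subst e t) ◅◅
  gmap (λ s → δ σ _ P s Q _) ξ-δ₂ (steps-subst (steps-exts e) s) ◅◅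
  gmap (δ σ _ P _ Q) ξ-δ₃ (steps-subst (steps-exts e) u)
steps-subst e (ν σ t)         = gmap (ν σ) ξ-ν (steps-subst e t)
steps-subst e (μ σ t)         = gmap (μ σ) ξ-μ (steps-subst e t)
steps-subst e (IC σ P t)      = gmap (IC σ P) ξ-IC (steps-subst (steps-exts e) t)
steps-subst e (t •[ σ ] s)    =
  gmap (_•[ σ ] _) ξ-•₁ (steps-subst e t) ◅◅ gmap (_ •[ σ ]_) ξ-•₂ (steps-subst e s)

steps-[] : ∀ (t : Term (suc n)) → s ⟶ r → t [ s ] ⟶* t [ r ]
steps-[] t st = steps-subst (λ { zero → st ◅ ε ; (suc x) → ε }) t

sn : Term n → Set
sn = Acc (λ u t → t ⟶ u)

sn-steps : sn t → t ⟶* t′ → sn t′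
sn-steps a ε         = a
sn-steps a (st ◅ ss) = sn-steps (acc-inverse a st) ss

sn-pair : sn t → sn s → sn (pair σ t s)
sn-pair (acc a) (acc b) = acc λ
  { (ξ-pair₁ st) → sn-pair (a st) (acc b)
  ; (ξ-pair₂ st) → sn-pair (acc a) (b st) }

sn-inj : sn t → sn (inj σ i t)
sn-inj (acc a) = acc λ { (ξ-inj st) → sn-inj (a st) }

sn-ν : sn t → sn (ν σ t)
sn-ν (acc a) = acc λ { (ξ-ν st) → sn-ν (a st) }

sn-IC : sn t → sn (IC σ Q t)
sn-IC (acc a) = acc λ { (ξ-IC st) → sn-IC (a st) }

-- Neutral terms and steps inside contexts

data NonValue {n} : Term n → Set where
  var  : ∀ {x} → NonValue (var x)
  _▶◀_ : ∀ t s → NonValue (t ▶◀[ Q ] s)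
  π    : NonValue (π σ i t)
  δ    : ∀ {P s Q u} → NonValue (δ σ t P s Q u)
  μ    : NonValue (μ σ t)
  •    : NonValue (t •[ σ ] s)

-- A case distinction is deliberately not neutral, even on a neutral scrutinee: its branches may
-- contain values that the surrounding context will eliminate after a substitution. Such terms are
-- left to the rule `split`.
data Neutral {n} : Term n → Set where
  var : ∀ x → Neutral (var x)
  π   : Neutral t → Neutral (π σ i t)
  μ   : Neutral t → Neutral (μ σ t)
  app : Neutral t → Neutral (t •[ σ ] s)
  ▶◀ˡ : Neutral t → Neutral (t ▶◀[ Q ] s)
  ▶◀ʳ : Neutral s → Neutral (t ▶◀[ Q ] s)

neutral-nonvalue : Neutral t → NonValue t
neutral-nonvalue (var x) = var
neutral-nonvalue (π h)   = π
neutral-nonvalue (μ h)   = μ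
neutral-nonvalue (app h) = •
neutral-nonvalue (▶◀ˡ h) = _ ▶◀ _
neutral-nonvalue (▶◀ʳ h) = _ ▶◀ _

neutral-step : Neutral t → t ⟶ t′ → Neutral t′
neutral-step (π ()) β-π
neutral-step (π h) (ξ-π st) = π (neutral-step h st)
neutral-step (μ ()) β-μ
neutral-step (μ h) (ξ-μ st) = μ (neutral-step h st)
neutral-step (app ()) β-•
neutral-step (app h) (ξ-•₁ st) = app (neutral-step h st)
neutral-step (app h) (ξ-•₂ st) = app h
neutral-step (▶◀ˡ ()) (β-pair A)
neutral-step (▶◀ˡ ()) (β-inj A)
neutral-step (▶◀ˡ ()) (β-ν A)
neutral-step (▶◀ˡ h) (ξ-▶◀₁ st) = ▶◀ˡ (neutral-step h st)
neutral-step (▶◀ˡ h) (ξ-▶◀₂ st) = ▶◀ˡ h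
neutral-step (▶◀ʳ ()) (β-pair A)
neutral-step (▶◀ʳ ()) (β-inj A)
neutral-step (▶◀ʳ ()) (β-ν A)
neutral-step (▶◀ʳ h) (ξ-▶◀₁ st) = ▶◀ʳ h
neutral-step (▶◀ʳ h) (ξ-▶◀₂ st) = ▶◀ʳ (neutral-step h st)

infix 4 _⟶ᶠ_

data _⟶ᶠ_ {n} : Frame n → Frame n → Set where
  ξ-•ᶠ   : s ⟶ r → (σ •ᶠ s) ⟶ᶠ (σ •ᶠ r)
  ξ-δᶠ₁  : ∀ {P s r} → s ⟶ r → δᶠ σ P s Q u ⟶ᶠ δᶠ σ P r Q u
  ξ-δᶠ₂  : ∀ {P u r} → u ⟶ r → δᶠ σ P s Q u ⟶ᶠ δᶠ σ P s Q r
  ξ-▶◀ᶠ  : s ⟶ r → (Q ▶◀ᶠ s) ⟶ᶠ (Q ▶◀ᶠ r)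
  ξ-▶◀ᶠ′ : s ⟶ r → ▶◀ᶠ′ Q s ⟶ᶠ ▶◀ᶠ′ Q r

plugᶠ-step : ∀ {f : Frame n} → t ⟶ t′ → plugᶠ f t ⟶ plugᶠ f t′
plugᶠ-step {f = σ •ᶠ s}       = ξ-•₁
plugᶠ-step {f = πᶠ σ i}       = ξ-π
plugᶠ-step {f = μᶠ σ}         = ξ-μ
plugᶠ-step {f = δᶠ σ P s Q u} = ξ-δ₁
plugᶠ-step {f = Q ▶◀ᶠ s}      = ξ-▶◀₁
plugᶠ-step {f = ▶◀ᶠ′ Q s}     = ξ-▶◀₂

plug-step : ∀ (K : Frames n) → t ⟶ t′ → plug K t ⟶ plug K t′
plug-step []      st = st
plug-step (f ∷ K) st = plugᶠ-step {f = f} (plug-step K st)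

frame-step : ∀ {f g : Frame n} → f ⟶ᶠ g → plugᶠ f t ⟶ plugᶠ g t
frame-step (ξ-•ᶠ st) = ξ-•₂ st
frame-step (ξ-δᶠ₁ st)  = ξ-δ₂ st
frame-step (ξ-δᶠ₂ st)  = ξ-δ₃ st
frame-step (ξ-▶◀ᶠ st)  = ξ-▶◀₂ st
frame-step (ξ-▶◀ᶠ′ st) = ξ-▶◀₁ st

frame-subst : ∀ (θ : Fin m → Term n) {f g : Frame m} → f ⟶ᶠ g → substᶠ θ f ⟶ᶠ substᶠ θ g
frame-subst θ (ξ-•ᶠ st)   = ξ-•ᶠ (step-subst θ st)
frame-subst θ (ξ-δᶠ₁ st)  = ξ-δᶠ₁ (step-subst (exts θ) st)
frame-subst θ (ξ-δᶠ₂ st)  = ξ-δᶠ₂ (step-subst (exts θ) st)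
frame-subst θ (ξ-▶◀ᶠ st)  = ξ-▶◀ᶠ (step-subst θ st)
frame-subst θ (ξ-▶◀ᶠ′ st) = ξ-▶◀ᶠ′ (step-subst θ st)

¬neutral-inj : ¬ Neutral (inj σ i t)
¬neutral-inj ()

plugᶠ-nonvalue : ∀ (f : Frame n) → NonValue (plugᶠ f t)
plugᶠ-nonvalue (σ •ᶠ s)       = •
plugᶠ-nonvalue (πᶠ σ i)       = π
plugᶠ-nonvalue (μᶠ σ)         = μ
plugᶠ-nonvalue (δᶠ σ P s Q u) = δ
plugᶠ-nonvalue (Q ▶◀ᶠ s)      = _ ▶◀ _
plugᶠ-nonvalue (▶◀ᶠ′ Q s)     = _ ▶◀ _

plug-nonvalue : ∀ (K : Frames n) → NonValue t → NonValue (plug K t)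
plug-nonvalue []      h = h
plug-nonvalue (f ∷ K) h = plugᶠ-nonvalue f

-- A β-step at the border between frame and hole would consume a pair, an injection, a `ν` or an
-- `IC` in the hole.
plugᶠ-step⁻¹ : ∀ (f : Frame n) → NonValue t → plugᶠ f t ⟶ u →
               (∃[ t′ ] t ⟶ t′ × u ≡ plugᶠ f t′) ⊎ (∃[ g ] f ⟶ᶠ g × u ≡ plugᶠ g t)
plugᶠ-step⁻¹ (σ •ᶠ s)       () β-•
plugᶠ-step⁻¹ (σ •ᶠ s)       h (ξ-•₁ st)  = inj₁ (_ , st , refl)
plugᶠ-step⁻¹ (σ •ᶠ s)       h (ξ-•₂ st)  = inj₂ (_ , ξ-•ᶠ st , refl)
plugᶠ-step⁻¹ (πᶠ σ i)       () β-π
plugᶠ-step⁻¹ (πᶠ σ i)       h (ξ-π st)   = inj₁ (_ , st , refl)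
plugᶠ-step⁻¹ (μᶠ σ)         () β-μ
plugᶠ-step⁻¹ (μᶠ σ)         h (ξ-μ st)   = inj₁ (_ , st , refl)
plugᶠ-step⁻¹ (δᶠ σ P s Q u) () β-δ
plugᶠ-step⁻¹ (δᶠ σ P s Q u) h (ξ-δ₁ st)  = inj₁ (_ , st , refl)
plugᶠ-step⁻¹ (δᶠ σ P s Q u) h (ξ-δ₂ st)  = inj₂ (_ , ξ-δᶠ₁ st , refl)
plugᶠ-step⁻¹ (δᶠ σ P s Q u) h (ξ-δ₃ st)  = inj₂ (_ , ξ-δᶠ₂ st , refl)
plugᶠ-step⁻¹ (Q ▶◀ᶠ s)      () (β-pair A)
plugᶠ-step⁻¹ (Q ▶◀ᶠ s)      () (β-inj A)
plugᶠ-step⁻¹ (Q ▶◀ᶠ s)      () (β-ν A)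
plugᶠ-step⁻¹ (Q ▶◀ᶠ s)      h (ξ-▶◀₁ st) = inj₁ (_ , st , refl)
plugᶠ-step⁻¹ (Q ▶◀ᶠ s)      h (ξ-▶◀₂ st) = inj₂ (_ , ξ-▶◀ᶠ st , refl)
plugᶠ-step⁻¹ (▶◀ᶠ′ Q s)     () (β-pair A)
plugᶠ-step⁻¹ (▶◀ᶠ′ Q s)     () (β-inj A)
plugᶠ-step⁻¹ (▶◀ᶠ′ Q s)     () (β-ν A)
plugᶠ-step⁻¹ (▶◀ᶠ′ Q s)     h (ξ-▶◀₁ st) = inj₂ (_ , ξ-▶◀ᶠ′ st , refl)
plugᶠ-step⁻¹ (▶◀ᶠ′ Q s)     h (ξ-▶◀₂ st) = inj₁ (_ , st , refl)

-- The second component is not an instance of the first, since _↑ changes the scope.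
infix 4 _⟶ᴷ_

_⟶ᴷ_ : Frames n → Frames n → Set
K ⟶ᴷ L = (∀ t → plug K t ⟶ plug L t) × (∀ t → plug (K ↑) t ⟶ plug (L ↑) t)

plug-step⁻¹ : ∀ (K : Frames n) → NonValue t → plug K t ⟶ u →
              (∃[ t′ ] t ⟶ t′ × u ≡ plug K t′) ⊎ (∃[ L ] K ⟶ᴷ L × u ≡ plug L t)
plug-step⁻¹ []      h st = inj₁ (_ , st , refl)
plug-step⁻¹ (f ∷ K) h st with plugᶠ-step⁻¹ f (plug-nonvalue K h) st
... | inj₂ (g , st′ , refl) =
      inj₂ (g ∷ K , ((λ _ → frame-step st′) , (λ _ → frame-step (frame-subst shift st′))) , refl)
... | inj₁ (_ , st′ , refl) with plug-step⁻¹ K h st′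
...   | inj₁ (t′ , st″ , refl)       = inj₁ (t′ , st″ , refl)
...   | inj₂ (L , (a , b) , refl) =
        inj₂ (f ∷ L , ((λ t → plugᶠ-step {f = f} (a t)) , (λ t → plugᶠ-step {f = substᶠ shift f} (b t))) , refl)

sn-unplug : ∀ (K : Frames n) → sn (plug K t) → sn t
sn-unplug K (acc a) = acc λ st → sn-unplug K (a (plug-step K st))

snᶠ : Frame n → Set
snᶠ = Acc (λ g f → f ⟶ᶠ g)

sn-plugᶠ : ∀ {f} → Neutral t → sn t → snᶠ f → sn (plugᶠ f t)
sn-plugᶠ {t = t} {f} h (acc a) (acc b) = acc step
  where
  step : plugᶠ f t ⟶ u → sn u
  step st with plugᶠ-step⁻¹ f (neutral-nonvalue h) st
  ... | inj₁ (_ , st′ , refl) = sn-plugᶠ {f = f} (neutral-step h st′) (a st′) (acc b)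
  ... | inj₂ (g , st′ , refl) = sn-plugᶠ {f = g} h (acc a) (b st′)

snᶠ-• : sn s → snᶠ (σ •ᶠ s)
snᶠ-• (acc a) = acc λ { (ξ-•ᶠ st) → snᶠ-• (a st) }

snᶠ-▶◀ : sn s → snᶠ (Q ▶◀ᶠ s)
snᶠ-▶◀ (acc a) = acc λ { (ξ-▶◀ᶠ st) → snᶠ-▶◀ (a st) }

snᶠ-▶◀′ : sn s → snᶠ (▶◀ᶠ′ Q s)
snᶠ-▶◀′ (acc a) = acc λ { (ξ-▶◀ᶠ′ st) → snᶠ-▶◀′ (a st) }

-- Contract r r′ d: the redex r contracts to r′, and every step inside r is a step of d.
data Contract {n} : Term n → Term n → Term n → Set where
  π    : ∀ {t s} → Contract (π σ i (pair σ t s)) (select i t s) (pair σ t s)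
  δ    : ∀ {t P s u} → Contract (δ σ (inj σ i t) P s Q u) (select i s u [ t ])
           (pair + (inj σ i t) (pair + (IC + P s) (IC + Q u)))
  μ    : Contract (μ σ (ν σ t)) t (ν σ t)
  •    : ∀ {t s} → Contract (IC σ Q t •[ σ ] s) (t [ s ]) (pair + (IC σ Q t) s)
  pair : ∀ {t u s} → Contract (pair σ t u ▶◀[ Q ] inj (opposite σ) i s) (cut σ Q (select i t u) s)
           (pair + (pair σ t u) (inj (opposite σ) i s))
  inj  : ∀ {t u s} → Contract (inj σ i t ▶◀[ Q ] pair (opposite σ) s u) (cut σ Q t (select i s u))
           (pair + (inj σ i t) (pair (opposite σ) s u))
  ν    : ∀ {t s} → Contract (ν σ t ▶◀[ Q ] ν (opposite σ) s)
           ((t •[ opposite σ ] s) ▶◀[ Q ] (s •[ σ ] t)) (pair + (ν σ t) (ν (opposite σ) s))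

contract-nonvalue : Contract r r′ d → NonValue r
contract-nonvalue π    = π
contract-nonvalue δ    = δ
contract-nonvalue μ    = μ
contract-nonvalue •    = •
contract-nonvalue pair = _ ▶◀ _
contract-nonvalue inj  = _ ▶◀ _
contract-nonvalue ν    = _ ▶◀ _

select-steps₁ : ∀ i → t ⟶ t′ → select i t u ⟶* select i t′ u
select-steps₁ one st = st ◅ ε
select-steps₁ two st = ε

select-steps₂ : ∀ i → u ⟶ r → select i t u ⟶* select i t r
select-steps₂ one st = ε
select-steps₂ two st = st ◅ ε

steps-[]ˡ : ∀ {t t′ : Term (suc n)} → t ⟶* t′ → t [ s ] ⟶* t′ [ s ]
steps-[]ˡ {s = s} = gmap (_[ s ]) (step-subst (single s))

steps-cut₁ : t ⟶* t′ → ∀ τ τ′ → (t •[ τ ] s) ▶◀[ Q ] (s •[ τ′ ] t) ⟶* (t′ •[ τ ] s) ▶◀[ Q ] (s •[ τ′ ] t′)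
steps-cut₁ st τ τ′ = gmap _ (ξ-▶◀₁ ∘ ξ-•₁) st ◅◅ gmap _ (ξ-▶◀₂ ∘ ξ-•₂) st

steps-cut₂ : s ⟶* r → ∀ τ τ′ → (t •[ τ ] s) ▶◀[ Q ] (s •[ τ′ ] t) ⟶* (t •[ τ ] r) ▶◀[ Q ] (r •[ τ′ ] t)
steps-cut₂ st τ τ′ = gmap _ (ξ-▶◀₁ ∘ ξ-•₂) st ◅◅ gmap _ (ξ-▶◀₂ ∘ ξ-•₁) st

-- The contracta are related by several steps or none, since contraction may copy or discard the
-- part that was reduced.
contract-step : Contract r r′ d → r ⟶ u →
                u ≡ r′ ⊎ (∃[ u′ ] ∃[ e ] Contract u u′ e × d ⟶ e × r′ ⟶* u′)
contract-step π β-π = inj₁ refl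
contract-step (π {i = i}) (ξ-π (ξ-pair₁ st)) = inj₂ (_ , _ , π , ξ-pair₁ st , select-steps₁ i st)
contract-step (π {i = i}) (ξ-π (ξ-pair₂ st)) = inj₂ (_ , _ , π , ξ-pair₂ st , select-steps₂ i st)
contract-step δ β-δ = inj₁ refl
contract-step (δ {i = i} {s = s} {u}) (ξ-δ₁ (ξ-inj st)) =
  inj₂ (_ , _ , δ , ξ-pair₁ (ξ-inj st) , steps-[] (select i s u) st)
contract-step (δ {i = i}) (ξ-δ₂ st) =
  inj₂ (_ , _ , δ , ξ-pair₂ (ξ-pair₁ (ξ-IC st)) , steps-[]ˡ (select-steps₁ i st))
contract-step (δ {i = i}) (ξ-δ₃ st) =
  inj₂ (_ , _ , δ , ξ-pair₂ (ξ-pair₂ (ξ-IC st)) , steps-[]ˡ (select-steps₂ i st))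
contract-step μ β-μ = inj₁ refl
contract-step μ (ξ-μ (ξ-ν st)) = inj₂ (_ , _ , μ , ξ-ν st , st ◅ ε)
contract-step • β-• = inj₁ refl
contract-step (• {s = s}) (ξ-•₁ (ξ-IC st)) =
  inj₂ (_ , _ , • , ξ-pair₁ (ξ-IC st) , step-subst (single s) st ◅ ε)
contract-step (• {t = t}) (ξ-•₂ st) = inj₂ (_ , _ , • , ξ-pair₂ st , steps-[] t st)
contract-step (pair {σ = σ}) (β-pair A) = inj₁ (⋈-classical σ A _)
contract-step (pair {σ = σ} {i = i}) (ξ-▶◀₁ (ξ-pair₁ st)) =
  inj₂ (_ , _ , pair , ξ-pair₁ (ξ-pair₁ st) , steps-cut₁ (select-steps₁ i st) _ _)
contract-step (pair {σ = σ} {i = i}) (ξ-▶◀₁ (ξ-pair₂ st)) =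
  inj₂ (_ , _ , pair , ξ-pair₁ (ξ-pair₂ st) , steps-cut₁ (select-steps₂ i st) _ _)
contract-step pair (ξ-▶◀₂ (ξ-inj st)) =
  inj₂ (_ , _ , pair , ξ-pair₂ (ξ-inj st) , steps-cut₂ (st ◅ ε) _ _)
contract-step (inj {σ = σ}) (β-inj A) = inj₁ (⋈-classical σ A _)
contract-step inj (ξ-▶◀₁ (ξ-inj st)) =
  inj₂ (_ , _ , inj , ξ-pair₁ (ξ-inj st) , steps-cut₁ (st ◅ ε) _ _)
contract-step (inj {i = i}) (ξ-▶◀₂ (ξ-pair₁ st)) =
  inj₂ (_ , _ , inj , ξ-pair₂ (ξ-pair₁ st) , steps-cut₂ (select-steps₁ i st) _ _)
contract-step (inj {i = i}) (ξ-▶◀₂ (ξ-pair₂ st)) =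
  inj₂ (_ , _ , inj , ξ-pair₂ (ξ-pair₂ st) , steps-cut₂ (select-steps₂ i st) _ _)
contract-step (ν {σ = σ}) (β-ν A) = inj₁ (⋈-classical-opposite σ A _)
contract-step ν (ξ-▶◀₁ (ξ-ν st)) = inj₂ (_ , _ , ν , ξ-pair₁ (ξ-ν st) , steps-cut₁ (st ◅ ε) _ _)
contract-step ν (ξ-▶◀₂ (ξ-ν st)) = inj₂ (_ , _ , ν , ξ-pair₂ (ξ-ν st) , steps-cut₂ (st ◅ ε) _ _)

steps-plug : ∀ (K : Frames n) → t ⟶* t′ → plug K t ⟶* plug K t′
steps-plug K = gmap (plug K) (plug-step K)

expand-step : ∀ (K : Frames n) → Contract r r′ d → sn (plug K r′) →
              (∀ L → plug K r′ ⟶ plug L r′ → sn (plug L r)) →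
              (∀ {u u′ e} → Contract u u′ e → d ⟶ e → plug K r′ ⟶* plug K u′ → sn (plug K u)) →
              plug K r ⟶ t → sn t
expand-step K c h h-frames h-redex st with plug-step⁻¹ K (contract-nonvalue c) st
... | inj₂ (L , (f , _) , refl) = h-frames L (f _)
... | inj₁ (_ , st′ , refl) with contract-step c st′
...   | inj₁ refl                     = h
...   | inj₂ (_ , _ , c′ , st″ , sts) = h-redex c′ st″ (steps-plug K sts)

-- Lexicographic induction on `sn d`, then on `sn (plug K r′)`. A step inside the redex may leave
-- the contractum unchanged but always decreases `d`; a step of the frames leaves `d` alone and is
-- also a step of `plug K r′`.
sn-expand : ∀ (K : Frames n) → Contract r r′ d → sn d → sn (plug K r′) → sn (plug K r)
sn-expand K c (acc a) (acc b) = acc (expand-step K c (acc b)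
  (λ L st → sn-expand L c (acc a) (b st))
  (λ c′ st sts → sn-expand K c′ (a st) (sn-steps (acc b) sts)))

-- A neutral scrutinee never selects a branch, so a branch can be normalized in the surrounding
-- context with its bound variable left free.
sn-split : ∀ (K : Frames n) {t σ P s Q u} → Neutral t → sn t →
           sn (plug (K ↑) s) → sn (plug (K ↑) u) → sn (plug K (δ σ t P s Q u))
sn-split K {t} {σ} {P} {s} {Q} {u} h (acc a) (acc b) (acc c) = acc step
  where
  step : ∀ {v} → plug K (δ σ t P s Q u) ⟶ v → sn v
  step st with plug-step⁻¹ K δ st
  ... | inj₂ (L , (_ , f) , refl)         = sn-split L h (acc a) (b (f s)) (c (f u))
  ... | inj₁ (_ , ξ-δ₁ st′ , refl)        = sn-split K (neutral-step h st′) (a st′) (acc b) (acc c)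
  ... | inj₁ (_ , ξ-δ₂ st′ , refl)        = sn-split K h (acc a) (b (plug-step (K ↑) st′)) (acc c)
  ... | inj₁ (_ , ξ-δ₃ st′ , refl)        = sn-split K h (acc a) (acc b) (c (plug-step (K ↑) st′))
  ... | inj₁ (_ , β-δ , refl)             = ⊥-elim (¬neutral-inj h)

-- Inductively defined strongly normalizing terms

-- A copy of `Type` with the sign as a parameter, so that dual rules become one.
data Ty : Set where
  str cls : Sign → Pure → Ty

Ctx : ℕ → Set
Ctx n = Vec Ty n

-- The signs of ∧ and ∨ are interchanged by duality: A ∧ B is a product when affirmed and a sum
-- when denied.
data Product : Sign → Pure → Pure → Pure → Set where
  ∧⁺ : ∀ {A B} → Product + (A ∧ B) A B
  ∨⁻ : ∀ {A B} → Product - (A ∨ B) A B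

data Sum : Sign → Pure → Pure → Pure → Set where
  ∨⁺ : ∀ {A B} → Sum + (A ∨ B) A B
  ∧⁻ : ∀ {A B} → Sum - (A ∧ B) A B

data Shape : Set where
  neutral any : Shape

private variable
  b        : Shape
  A B D    : Pure
  P P₁ P₂ P₃ : Ty
  Γ Δ      : Ctx n

mutual
  -- SN Γ neutral t P: moreover, head reduction and case splits of t lead to neutral terms only.
  data SN {n} (Γ : Ctx n) : Shape → Term n → Ty → Set where
    ne     : NE Γ t P → SN Γ b t P
    expand : ∀ K → Redex Γ r r′ → SN Γ b (plug K r′) P → SN Γ b (plug K r) P
    split  : ∀ K {s u} → NE Γ t (str σ D) → Sum σ D A B →
             SN (cls σ A ∷ Γ) b (plug (K ↑) s) P → SN (cls σ B ∷ Γ) b (plug (K ↑) u) P →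
             SN Γ b (plug K (δ σ t Q s R u)) P
    pair   : Product σ D A B → SN Γ any t (cls σ A) → SN Γ any s (cls σ B) →
             SN Γ any (pair σ t s) (str σ D)
    inj    : Sum σ D A B → SN Γ any t (cls σ (select i A B)) → SN Γ any (inj σ i t) (str σ D)
    ν      : SN Γ any t (cls (opposite σ) A) → SN Γ any (ν σ t) (str σ (neg A))
    IC     : ∀ {t} → SN (cls (opposite σ) A ∷ Γ) any t (str σ A) → SN Γ any (IC σ Q t) (cls σ A)

  data NE {n} (Γ : Ctx n) : Term n → Ty → Set where
    var : ∀ x → lookup Γ x ≡ P → NE Γ (var x) P
    app : NE Γ t (cls σ A) → SN Γ any s (cls (opposite σ) A) → NE Γ (t •[ σ ] s) (str σ A)
    π   : Product σ D A B → NE Γ t (str σ D) → NE Γ (π σ i t) (cls σ (select i A B))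
    μ   : NE Γ t (str σ (neg A)) → NE Γ (μ σ t) (cls (opposite σ) A)
    ▶◀ˡ : NE Γ t (str σ A) → SN Γ any s (str (opposite σ) A) → NE Γ (t ▶◀[ Q ] s) P
    ▶◀ʳ : SN Γ any t (str σ A) → NE Γ s (str (opposite σ) A) → NE Γ (t ▶◀[ Q ] s) P

  -- The premises secure the parts of the redex that contraction may discard. In `δ`, a branch is
  -- only known to be in `SN` inside some context, as in `split`; the contexts `K` and `L` are
  -- arbitrary because `sn-unplug` removes them.
  data Redex {n} (Γ : Ctx n) : Term n → Term n → Set where
    π    : SN Γ any t P₁ → SN Γ any s P₂ → Redex Γ (π σ i (pair σ t s)) (select i t s)
    δ    : ∀ {s u} K L → SN Γ any t P₁ → SN (P₂ ∷ Γ) any (plug K s) P → SN (P₃ ∷ Γ) any (plug L u) P →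
           Redex Γ (δ σ (inj σ i t) Q s R u) (select i s u [ t ])
    μ    : SN Γ any t P → Redex Γ (μ σ (ν σ t)) t
    •    : ∀ {t} → SN (P₁ ∷ Γ) any t P → SN Γ any s P₂ → Redex Γ (IC σ Q t •[ σ ] s) (t [ s ])
    pair : SN Γ any t P₁ → SN Γ any u P₂ → SN Γ any s P₃ →
           Redex Γ (pair σ t u ▶◀[ Q ] inj (opposite σ) i s) (cut σ Q (select i t u) s)
    inj  : SN Γ any t P₁ → SN Γ any s P₂ → SN Γ any u P₃ →
           Redex Γ (inj σ i t ▶◀[ Q ] pair (opposite σ) s u) (cut σ Q t (select i s u))
    ν    : SN Γ any t P₁ → SN Γ any s P₂ →
           Redex Γ (ν σ t ▶◀[ Q ] ν (opposite σ) s) ((t •[ opposite σ ] s) ▶◀[ Q ] (s •[ σ ] t))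

NE⇒neutral : NE Γ t P → Neutral t
NE⇒neutral (var x _) = var x
NE⇒neutral (app h _) = app (NE⇒neutral h)
NE⇒neutral (π _ h)   = π (NE⇒neutral h)
NE⇒neutral (μ h)     = μ (NE⇒neutral h)
NE⇒neutral (▶◀ˡ h _) = ▶◀ˡ (NE⇒neutral h)
NE⇒neutral (▶◀ʳ _ h) = ▶◀ʳ (NE⇒neutral h)

SN⇒sn : SN Γ b t P → sn t
NE⇒sn : NE Γ t P → sn t
Redex⇒contract : Redex Γ r r′ → ∃[ d ] Contract r r′ d × sn d

SN⇒sn (ne h)            = NE⇒sn h
SN⇒sn (expand K r h) with _ , c , sd ← Redex⇒contract r = sn-expand K c sd (SN⇒sn h)
SN⇒sn (split K h _ a b) = sn-split K (NE⇒neutral h) (NE⇒sn h) (SN⇒sn a) (SN⇒sn b)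
SN⇒sn (pair _ h k)      = sn-pair (SN⇒sn h) (SN⇒sn k)
SN⇒sn (inj _ h)         = sn-inj (SN⇒sn h)
SN⇒sn (ν h)             = sn-ν (SN⇒sn h)
SN⇒sn (IC h)            = sn-IC (SN⇒sn h)

NE⇒sn (var x _) = acc λ ()
NE⇒sn (app {σ = σ} {s = s} h k) = sn-plugᶠ {f = σ •ᶠ s} (NE⇒neutral h) (NE⇒sn h) (snᶠ-• (SN⇒sn k))
NE⇒sn (π {σ = σ} {i = i} _ h)   = sn-plugᶠ {f = πᶠ σ i} (NE⇒neutral h) (NE⇒sn h) (acc λ ())
NE⇒sn (μ {σ = σ} h)             = sn-plugᶠ {f = μᶠ σ} (NE⇒neutral h) (NE⇒sn h) (acc λ ())
NE⇒sn (▶◀ˡ {s = s} {Q = Q} h k) = sn-plugᶠ {f = Q ▶◀ᶠ s} (NE⇒neutral h) (NE⇒sn h) (snᶠ-▶◀ (SN⇒sn k))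
NE⇒sn (▶◀ʳ {t = t} {Q = Q} h k) = sn-plugᶠ {f = ▶◀ᶠ′ Q t} (NE⇒neutral k) (NE⇒sn k) (snᶠ-▶◀′ (SN⇒sn h))

Redex⇒contract (π h k)       = _ , π , sn-pair (SN⇒sn h) (SN⇒sn k)
Redex⇒contract (δ K L h k l) = _ , δ , sn-pair (sn-inj (SN⇒sn h))
  (sn-pair (sn-IC (sn-unplug K (SN⇒sn k))) (sn-IC (sn-unplug L (SN⇒sn l))))
Redex⇒contract (μ h)         = _ , μ , sn-ν (SN⇒sn h)
Redex⇒contract (• h k)       = _ , • , sn-pair (sn-IC (SN⇒sn h)) (SN⇒sn k)
Redex⇒contract (pair h k l)  = _ , pair , sn-pair (sn-pair (SN⇒sn h) (SN⇒sn k)) (sn-inj (SN⇒sn l))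
Redex⇒contract (inj h k l)   = _ , inj , sn-pair (sn-inj (SN⇒sn h)) (sn-pair (SN⇒sn k) (SN⇒sn l))
Redex⇒contract (ν h k)       = _ , ν , sn-pair (sn-ν (SN⇒sn h)) (sn-ν (SN⇒sn k))

SN-any : SN Γ b t P → SN Γ any t P
SN-any (ne h)               = ne h
SN-any (expand K r h)       = expand K r (SN-any h)
SN-any (split K h s h₁ h₂)  = split K h s (SN-any h₁) (SN-any h₂)
SN-any (pair p h k)         = pair p h k
SN-any (inj s h)            = inj s h
SN-any (ν h)                = ν h
SN-any (IC h)               = IC h

SN-≡ : SN Γ b t P → u ≡ t → SN Γ b u P
SN-≡ h refl = h

-- Renaming of derivations

Renaming : (Fin m → Fin n) → Ctx m → Ctx n → Set
Renaming ρ Γ Δ = ∀ x → lookup Δ (ρ x) ≡ lookup Γ x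

ext-renaming : {ρ : Fin m → Fin n} → Renaming ρ Γ Δ → Renaming (ext ρ) (P ∷ Γ) (P ∷ Δ)
ext-renaming h zero    = refl
ext-renaming h (suc x) = h x

rename-SN : {ρ : Fin m → Fin n} → Renaming ρ Γ Δ → SN Γ b t P → SN Δ b (rename ρ t) P
rename-NE : {ρ : Fin m → Fin n} → Renaming ρ Γ Δ → NE Γ t P → NE Δ (rename ρ t) P
rename-Redex : {ρ : Fin m → Fin n} → Renaming ρ Γ Δ → Redex Γ r r′ → Redex Δ (rename ρ r) (rename ρ r′)

rename-SN h (ne k) = ne (rename-NE h k)
rename-SN {ρ = ρ} h (expand {r = r} {r′} K red k) = SN-≡
  (expand (substᴷ (var ∘ ρ) K) (rename-Redex h red) (SN-≡ (rename-SN h k) (sym (rename-plug ρ K r′))))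
  (rename-plug ρ K r)
rename-SN {ρ = ρ} h (split K {s} {u} k sum k₁ k₂) = SN-≡
  (split (substᴷ (var ∘ ρ) K) (rename-NE h k) sum
    (SN-≡ (rename-SN (ext-renaming h) k₁) (sym (rename-plug-↑ ρ K s)))
    (SN-≡ (rename-SN (ext-renaming h) k₂) (sym (rename-plug-↑ ρ K u))))
  (rename-plug ρ K _)
rename-SN h (pair p k l) = pair p (rename-SN h k) (rename-SN h l)
rename-SN h (inj s k)    = inj s (rename-SN h k)
rename-SN h (ν k)        = ν (rename-SN h k)
rename-SN h (IC k)       = IC (rename-SN (ext-renaming h) k)

rename-NE {ρ = ρ} h (var x e) = var (ρ x) (trans (h x) e)
rename-NE h (app k l)         = app (rename-NE h k) (rename-SN h l)
rename-NE h (π p k)           = π p (rename-NE h k)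
rename-NE h (μ k)             = μ (rename-NE h k)
rename-NE h (▶◀ˡ k l)         = ▶◀ˡ (rename-NE h k) (rename-SN h l)
rename-NE h (▶◀ʳ k l)         = ▶◀ʳ (rename-SN h k) (rename-NE h l)

Redex-≡ : Redex Γ r r′ → u ≡ r′ → Redex Γ r u
Redex-≡ h refl = h

rename-Redex {ρ = ρ} h (π {i = i} k l) =
  Redex-≡ (π (rename-SN h k) (rename-SN h l)) (rename-select ρ i _ _)
rename-Redex {ρ = ρ} h (δ {t = t} {i = i} {s = s} {u} K L k l m) = Redex-≡
  (δ (substᴷ (var ∘ ext ρ) K) (substᴷ (var ∘ ext ρ) L) (rename-SN h k)
    (SN-≡ (rename-SN (ext-renaming h) l) (sym (rename-plug (ext ρ) K s)))
    (SN-≡ (rename-SN (ext-renaming h) m) (sym (rename-plug (ext ρ) L u))))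
  (trans (rename-[] ρ (select i s u) t) (cong (_[ rename ρ t ]) (rename-select (ext ρ) i s u)))
rename-Redex h (μ k) = μ (rename-SN h k)
rename-Redex {ρ = ρ} h (• {s = s} {t = t} k l) =
  Redex-≡ (• (rename-SN (ext-renaming h) k) (rename-SN h l)) (rename-[] ρ t s)
rename-Redex {ρ = ρ} h (pair {σ = σ} {Q = Q} {i = i} k l m) = Redex-≡
  (pair (rename-SN h k) (rename-SN h l) (rename-SN h m))
  (cong (λ t → cut σ Q t _) (rename-select ρ i _ _))
rename-Redex {ρ = ρ} h (inj {σ = σ} {i = i} {Q = Q} k l m) = Redex-≡
  (inj (rename-SN h k) (rename-SN h l) (rename-SN h m))
  (cong (cut σ Q _) (rename-select ρ i _ _))
rename-Redex h (ν k l) = ν (rename-SN h k) (rename-SN h l)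

weaken : SN Γ b t P → SN (P₁ ∷ Γ) b (subst shift t) P
weaken {t = t} h = SN-≡ (rename-SN (λ _ → refl) h) (sym (rename-as-subst (λ _ → refl) t))

-- Closure under eliminations

record Good (A : Pure) : Set where
  field
    sub      : ∀ {n} {Γ : Ctx n} {σ s t P} → SN (cls σ A ∷ Γ) any t P → SN Γ any s (cls σ A) →
               SN Γ any (t [ s ]) P
    -- The type `P` is arbitrary and may be larger than `A`, so nothing is known about eliminating
    -- its values. The shape `neutral` guarantees that none arises.
    absurdity : ∀ {n} {Γ : Ctx n} {σ t s Q P} → SN Γ any t (str σ A) → SN Γ any s (str (opposite σ) A) →
               SN Γ neutral (t ▶◀[ Q ] s) P

open Good

-- Strong induction in unfolded form: eliminating a value yields a component, which must be
-- eliminable in turn.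
Below : Pure → Set
Below (atom _) = ⊤
Below (A ∧ B)  = (Good A × Below A) × (Good B × Below B)
Below (A ∨ B)  = (Good A × Below A) × (Good B × Below B)
Below (neg A)  = Good A × Below A

-- What must be known for a term in SN Γ b t P to be eliminated.
Eliminable : Shape → Ty → Set
Eliminable neutral _         = ⊤
Eliminable any     (str σ A) = Below A
Eliminable any     (cls σ A) = Good A × Below A

below-product : Product σ D A B → ∀ i → Below D → Eliminable any (cls σ (select i A B))
below-product ∧⁺ one (e , _) = e
below-product ∧⁺ two (_ , e) = e
below-product ∨⁻ one (e , _) = e
below-product ∨⁻ two (_ , e) = e

below-sum : Sum σ D A B → ∀ i → Below D → Eliminable any (cls σ (select i A B))
below-sum ∨⁺ one (e , _) = e
below-sum ∨⁺ two (_ , e) = e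
below-sum ∧⁻ one (e , _) = e
below-sum ∧⁻ two (_ , e) = e

eliminable-π : ∀ b → Product σ D A B → ∀ i → Eliminable b (str σ D) → Eliminable b (cls σ (select i A B))
eliminable-π neutral p i _ = _
eliminable-π any     p i e = below-product p i e

-- Only `IC` calls on the hypothesis about `A`, and `IC` does not occur in shape `neutral`, where
-- `Eliminable` is trivial.
SN-app : Eliminable b (cls σ A) → SN Γ b t (cls σ A) → SN Γ any s (cls (opposite σ) A) →
         SN Γ b (t •[ σ ] s) (str σ A)
SN-app e (ne h) k                = ne (app h k)
SN-app {σ = σ} {s = s} e (expand K r h) k = expand ((σ •ᶠ s) ∷ K) r (SN-app e h k)
SN-app {σ = σ} {s = s} e (split K n d h₁ h₂) k =
  split ((σ •ᶠ s) ∷ K) n d (SN-app e h₁ (weaken k)) (SN-app e h₂ (weaken k))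
SN-app (g , _) (IC h) k          = expand [] (• h k) (sub g h k)

SN-select : ∀ i → SN Γ b t (cls σ A) → SN Γ b s (cls σ B) → SN Γ b (select i t s) (cls σ (select i A B))
SN-select one h k = h
SN-select two h k = k

SN-π : Product σ D A B → SN Γ b t (str σ D) → SN Γ b (π σ i t) (cls σ (select i A B))
SN-π p (ne h)               = ne (π p h)
SN-π {i = i} p (expand K r h) = expand (πᶠ _ i ∷ K) r (SN-π p h)
SN-π {i = i} p (split K n d h₁ h₂)  = split (πᶠ _ i ∷ K) n d (SN-π p h₁) (SN-π p h₂)
SN-π {i = i} ∧⁺ (pair ∧⁺ h k) = expand [] (π h k) (SN-select i h k)
SN-π {i = i} ∨⁻ (pair ∨⁻ h k) = expand [] (π h k) (SN-select i h k)
SN-π () (inj ∨⁺ h)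
SN-π () (inj ∧⁻ h)
SN-π () (ν h)

SN-μ : SN Γ b t (str σ (neg A)) → SN Γ b (μ σ t) (cls (opposite σ) A)
SN-μ (ne h)              = ne (μ h)
SN-μ (expand K r h)      = expand (μᶠ _ ∷ K) r (SN-μ h)
SN-μ (split K n d h₁ h₂) = split (μᶠ _ ∷ K) n d (SN-μ h₁) (SN-μ h₂)
SN-μ (pair () h k)
SN-μ (inj () h)
SN-μ (ν h)               = expand [] (μ h) h

-- The context `K` is part of the statement because the branches are given inside it. When the
-- scrutinee is itself a split, the whole outer case distinction is copied into each of its
-- branches; this is the commuting conversion, carried out on derivations.
SN-δ : Eliminable b (str σ D) → Sum σ D A B → SN Γ b t (str σ D) → ∀ K {s u} →
       SN (cls σ A ∷ Γ) any (plug (K ↑) s) P → SN (cls σ B ∷ Γ) any (plug (K ↑) u) P →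
       SN Γ any (plug K (δ σ t Q s R u)) P
SN-δ e d (ne n) K h k = split K n d h k
SN-δ {σ = σ} {Q = Q} {R = R} e d (expand {r = r} {r′} L red t) K {s} {u} h k =
  SN-≡ (expand M red (SN-≡ (SN-δ e d t K h k) (plug-++ K (δᶠ σ Q s R u ∷ L) r′)))
       (sym (plug-++ K (δᶠ σ Q s R u ∷ L) r))
  where M = K ++ δᶠ σ Q s R u ∷ L
SN-δ {b = b} {σ = σ} {Q = Q} {R = R} e d (split L {s′} {u′} n d′ t₁ t₂) K {s} {u} h k =
  SN-≡ (split M n d′ (branch s′ t₁) (branch u′ t₂)) (sym (plug-++ K (δᶠ σ Q s R u ∷ L) _))
  where
  M = K ++ δᶠ σ Q s R u ∷ L
  -- The variable bound by the inner split is inserted behind the one bound by the outer branch.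
  lift : ∀ v {P P₁ P₂} {Γ : Ctx _} → SN (P₁ ∷ Γ) any (plug (K ↑) v) P →
         SN (P₁ ∷ P₂ ∷ Γ) any (plug (K ↑ ↑) (subst (exts shift) v)) P
  lift v h = SN-≡ (rename-SN {ρ = ext suc} (ext-renaming (λ _ → refl)) h)
    (sym (trans (rename-plug-↑ suc K v) (cong (plug (K ↑ ↑)) (rename-ext suc v))))
  branch : ∀ v {P₁} → SN (P₁ ∷ _) b (plug (L ↑) v) _ → SN (P₁ ∷ _) any (plug (M ↑) v) _
  branch v t = SN-≡ (SN-δ e d t (K ↑) (lift s h) (lift u k))
    (trans (cong (λ K → plug K v) (map-++ (substᶠ shift) K (δᶠ σ Q s R u ∷ L)))
           (plug-++ (K ↑) (substᶠ shift (δᶠ σ Q s R u) ∷ L ↑) v))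
SN-δ e ∨⁺ (inj {i = one} ∨⁺ t) K h k = expand K (δ (K ↑) (K ↑) t h k)
  (SN-≡ (sub (proj₁ (below-sum ∨⁺ one e)) h t) (sym (plug-[] K _ _)))
SN-δ e ∨⁺ (inj {i = two} ∨⁺ t) K h k = expand K (δ (K ↑) (K ↑) t h k)
  (SN-≡ (sub (proj₁ (below-sum ∨⁺ two e)) k t) (sym (plug-[] K _ _)))
SN-δ e ∧⁻ (inj {i = one} ∧⁻ t) K h k = expand K (δ (K ↑) (K ↑) t h k)
  (SN-≡ (sub (proj₁ (below-sum ∧⁻ one e)) h t) (sym (plug-[] K _ _)))
SN-δ e ∧⁻ (inj {i = two} ∧⁻ t) K h k = expand K (δ (K ↑) (K ↑) t h k)
  (SN-≡ (sub (proj₁ (below-sum ∧⁻ two e)) k t) (sym (plug-[] K _ _)))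
SN-δ e () (pair ∧⁺ h k) K l m
SN-δ e () (pair ∨⁻ h k) K l m
SN-δ e () (ν h) K l m

-- Absurdities between terms of opposite types

SN-opposite : SN Γ b t (cls σ A) → SN Γ b t (cls (opposite (opposite σ)) A)
SN-opposite {σ = +} h = h
SN-opposite {σ = - } h = h

SN-cut : Good A × Below A → SN Γ any t (cls σ A) → SN Γ any s (cls (opposite σ) A) →
         SN Γ neutral (cut σ Q t s) P
SN-cut e h k = absurdity (proj₁ e) (SN-app e h k) (SN-app e k (SN-opposite h))

product-sum : Product σ D A B → ∀ {A′ B′} → Sum (opposite σ) D A′ B′ → A ≡ A′ × B ≡ B′
product-sum ∧⁺ ∧⁻ = refl , refl
product-sum ∨⁻ ∨⁺ = refl , refl

sum-product : Sum σ D A B → ∀ {A′ B′} → Product (opposite σ) D A′ B′ → A ≡ A′ × B ≡ B′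
sum-product ∨⁺ ∨⁻ = refl , refl
sum-product ∧⁻ ∧⁺ = refl , refl

SN-▶◀ʳ : SN Γ any t (str σ A) → SN Γ neutral s (str (opposite σ) A) → SN Γ neutral (t ▶◀[ Q ] s) P
SN-▶◀ʳ h (ne k)              = ne (▶◀ʳ h k)
SN-▶◀ʳ h (expand K r k)      = expand (▶◀ᶠ′ _ _ ∷ K) r (SN-▶◀ʳ h k)
SN-▶◀ʳ h (split K n d k₁ k₂) = split (▶◀ᶠ′ _ _ ∷ K) n d (SN-▶◀ʳ (weaken h) k₁) (SN-▶◀ʳ (weaken h) k₂)

SN-pair▶◀ : Below D → Product σ D A B → SN Γ any t (cls σ A) → SN Γ any u (cls σ B) →
            SN Γ any s (str (opposite σ) D) → SN Γ neutral (pair σ t u ▶◀[ Q ] s) P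
SN-pair▶◀ e p h l (ne k)              = ne (▶◀ʳ (pair p h l) k)
SN-pair▶◀ e p h l (expand K r k)      = expand (▶◀ᶠ′ _ _ ∷ K) r (SN-pair▶◀ e p h l k)
SN-pair▶◀ e p h l (split K n d k₁ k₂) = split (▶◀ᶠ′ _ _ ∷ K) n d
  (SN-pair▶◀ e p (weaken h) (weaken l) k₁) (SN-pair▶◀ e p (weaken h) (weaken l) k₂)
SN-pair▶◀ {σ = σ} e p h l (inj {i = i} d k) with refl , refl ← product-sum p d =
  expand [] (pair h l k) (SN-cut (below-product p i e) (SN-select i h l) k)
SN-pair▶◀ e ∧⁺ h l (pair () _ _)
SN-pair▶◀ e ∨⁻ h l (pair () _ _)
SN-pair▶◀ e () h l (ν k)

SN-inj▶◀ : Below D → Sum σ D A B → SN Γ any t (cls σ (select i A B)) →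
           SN Γ any s (str (opposite σ) D) → SN Γ neutral (inj σ i t ▶◀[ Q ] s) P
SN-inj▶◀ e p h (ne k)              = ne (▶◀ʳ (inj p h) k)
SN-inj▶◀ e p h (expand K r k)      = expand (▶◀ᶠ′ _ _ ∷ K) r (SN-inj▶◀ e p h k)
SN-inj▶◀ e p h (split K n d k₁ k₂) = split (▶◀ᶠ′ _ _ ∷ K) n d
  (SN-inj▶◀ e p (weaken h) k₁) (SN-inj▶◀ e p (weaken h) k₂)
SN-inj▶◀ {σ = σ} {i = i} e p h (pair d k l) with refl , refl ← sum-product p d =
  expand [] (inj h k l) (SN-cut (below-sum p i e) h (SN-select i k l))
SN-inj▶◀ e ∨⁺ h (inj () _)
SN-inj▶◀ e ∧⁻ h (inj () _)
SN-inj▶◀ e () h (ν k)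

SN-ν▶◀ : Below (neg A) → SN Γ any t (cls (opposite σ) A) →
         SN Γ any s (str (opposite σ) (neg A)) → SN Γ neutral (ν σ t ▶◀[ Q ] s) P
SN-ν▶◀ e h (ne k)              = ne (▶◀ʳ (ν h) k)
SN-ν▶◀ e h (expand K r k)      = expand (▶◀ᶠ′ _ _ ∷ K) r (SN-ν▶◀ e h k)
SN-ν▶◀ e h (split K n d k₁ k₂) = split (▶◀ᶠ′ _ _ ∷ K) n d
  (SN-ν▶◀ e (weaken h) k₁) (SN-ν▶◀ e (weaken h) k₂)
SN-ν▶◀ e h (pair () _ _)
SN-ν▶◀ e h (inj () _)
SN-ν▶◀ {σ = +} e h (ν k) = expand [] (ν h k) (SN-cut e h k)
SN-ν▶◀ {σ = - } e h (ν k) = expand [] (ν h k) (SN-cut e h k)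

-- The left operand is brought to a value or a neutral term, then the right one. Two values of
-- opposite strong types always match one of the β-rules, and the resulting cut is at a component of
-- `A`. So only neutral terms remain in the end.
SN-▶◀ : Eliminable b (str σ A) → SN Γ b t (str σ A) → SN Γ any s (str (opposite σ) A) →
        SN Γ neutral (t ▶◀[ Q ] s) P
SN-▶◀ e (ne h) k              = ne (▶◀ˡ h k)
SN-▶◀ e (expand K r h) k      = expand ((_ ▶◀ᶠ _) ∷ K) r (SN-▶◀ e h k)
SN-▶◀ e (split K n d h₁ h₂) k = split ((_ ▶◀ᶠ _) ∷ K) n d (SN-▶◀ e h₁ (weaken k)) (SN-▶◀ e h₂ (weaken k))
SN-▶◀ e (pair p h l) k        = SN-pair▶◀ e p h l k
SN-▶◀ e (inj p h) k           = SN-inj▶◀ e p h k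
SN-▶◀ e (ν h) k               = SN-ν▶◀ e h k

-- Substitution for classical variables

module Levels (A : Pure) (below : Below A) where

  Predicate : Set₁
  Predicate = ∀ {n} → Ctx n → Term n → Set

  -- Renamings are quantified as in Kripke models, since tests are also applied under further
  -- binders, as in `W-split`. The conjunct in `SN` keeps the predicate meaningful when there are no
  -- tests.
  Orthogonal : Sign → Predicate → Predicate
  Orthogonal σ Z Γ t = SN Γ any t (cls σ A) ×
    (∀ {m} {Δ : Ctx m} ρ → Renaming ρ Γ Δ → ∀ {s} → Z Δ s → SN Δ any (rename ρ t •[ σ ] s) (str σ A))

  -- A ⊕ and A ⊖ should be each other's tests, which is a fixed point equation.  It is solved by
  -- approximation: W + i is orthogonal to W - i and increases with i, while W - (suc i) is
  -- orthogonal to W + i and decreases.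
  Tests⁻ : ℕ → Predicate
  Tests⁻ zero    = λ _ _ → ⊥
  Tests⁻ (suc i) = Orthogonal + (Orthogonal - (Tests⁻ i))

  Tests : Sign → ℕ → Predicate
  Tests + i = Orthogonal - (Tests⁻ i)
  Tests - i = Tests⁻ i

  W : Sign → ℕ → Predicate
  W σ i = Orthogonal σ (Tests σ i)

  Tests-SN : ∀ σ i → Tests σ i Γ s → SN Γ any s (cls (opposite σ) A)
  Tests-SN + i       (h , _) = h
  Tests-SN - (suc i) (h , _) = h

  Orthogonal-rename : ∀ {Z : Predicate} {ρ : Fin m → Fin n} → Renaming ρ Γ Δ →
                      Orthogonal σ Z Γ t → Orthogonal σ Z Δ (rename ρ t)
  Orthogonal-rename {σ = σ} {t = t} hρ (h , k) = rename-SN hρ h , λ ρ′ hρ′ {s} z →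
    SN-≡ (k (ρ′ ∘ _) (λ x → trans (hρ′ _) (hρ x)) z)
         (cong (_•[ σ ] s) (rename-rename (λ _ → refl) t))

  Tests-rename : ∀ σ i {ρ : Fin m → Fin n} → Renaming ρ Γ Δ → Tests σ i Γ s → Tests σ i Δ (rename ρ s)
  Tests-rename + i       hρ z = Orthogonal-rename {Z = Tests - i} hρ z
  Tests-rename - (suc i) hρ z = Orthogonal-rename {Z = Tests + i} hρ z

  mutual
    -- By unfolding, `W + i` is tested by `W - i`, and `W - (suc i)` by `W + i`. Each inclusion
    -- reverses into the next one, starting from `W - zero`, which has no tests.
    W⁺-mono : ∀ {i j} → i ≤ j → W + i Γ t → W + j Γ t
    W⁺-mono i≤j (h , k) = h , λ ρ hρ z → k ρ hρ (W⁻-anti i≤j z)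

    W⁻-anti : ∀ {i j} → i ≤ j → W - j Γ t → W - i Γ t
    W⁻-anti z≤n       (h , k) = h , λ _ _ ()
    W⁻-anti (s≤s i≤j) (h , k) = h , λ ρ hρ z → k ρ hρ (W⁺-mono i≤j z)

  W-app : ∀ σ i → W σ i Γ t → Tests σ i Γ s → SN Γ any (t •[ σ ] s) (str σ A)
  W-app {t = t} {s} σ i (_ , k) z =
    SN-≡ (k id (λ _ → refl) z) (cong (_•[ σ ] s) (sym (rename-id (λ _ → refl) t)))

  W-≡ : ∀ σ i → W σ i Γ t → u ≡ t → W σ i Γ u
  W-≡ σ i h refl = h

  W-eliminable : ∀ σ i → Eliminable b (cls σ A) → SN Γ b t (cls σ A) → W σ i Γ t
  W-eliminable σ i e h = SN-any h , λ ρ hρ z → SN-any (SN-app e (rename-SN hρ h) (Tests-SN σ i z))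

  W-NE : ∀ σ i → NE Γ t (cls σ A) → W σ i Γ t
  W-NE σ i h = W-eliminable {b = neutral} σ i _ (ne h)

  W-expand : ∀ σ i K → Redex Γ r r′ → W σ i Γ (plug K r′) → W σ i Γ (plug K r)
  W-expand {r = r} {r′} σ i K red (h , k) = expand K red h , λ ρ hρ {s} z →
    SN-≡ (expand ((σ •ᶠ s) ∷ substᴷ (var ∘ ρ) K) (rename-Redex hρ red)
           (SN-≡ (k ρ hρ z) (cong (_•[ σ ] s) (sym (rename-plug ρ K r′)))))
         (cong (_•[ σ ] s) (rename-plug ρ K r))

  W-split : ∀ σ i {τ B C s u} → Eliminable b (str τ D) → Sum τ D B C → SN Γ b t (str τ D) → ∀ K →
            W σ i (cls τ B ∷ Γ) (plug (K ↑) s) → W σ i (cls τ C ∷ Γ) (plug (K ↑) u) →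
            W σ i Γ (plug K (δ τ t Q s R u))
  W-split {Γ = Γ} σ i {s = s} {u} e d h K k₁ k₂ =
    SN-δ e d h K (proj₁ k₁) (proj₁ k₂) , λ ρ hρ {v} z →
      SN-≡ (SN-δ e d (rename-SN hρ h) ((σ •ᶠ v) ∷ substᴷ (var ∘ ρ) K)
             (branch ρ hρ z s k₁) (branch ρ hρ z u k₂))
           (cong (_•[ σ ] v) (rename-plug ρ K _))
    where
    branch : ∀ {m} {Δ : Ctx m} (ρ : Fin _ → Fin m) → Renaming ρ Γ Δ → ∀ {v} → Tests σ i Δ v →
             ∀ s {P} → W σ i (P ∷ Γ) (plug (K ↑) s) →
             SN (P ∷ Δ) any (plug (substᴷ (var ∘ ρ) K ↑) (rename (ext ρ) s) •[ σ ] subst shift v) (str σ A)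
    branch ρ hρ {v} z s (_ , k) = SN-≡
      (k (ext ρ) (ext-renaming hρ) (Tests-rename σ i (λ _ → refl) z))
      (cong₂ (_•[ σ ]_) (sym (rename-plug-↑ ρ K s)) (sym (rename-as-subst (λ _ → refl) v)))

  -- The body is needed twice: with its variable left free, for the abstraction itself, and with a
  -- test in its place, for the contractum of an application.
  W-IC : ∀ σ i {θ : Fin m → Term n} t →
         SN (cls (opposite σ) A ∷ Γ) any (subst (exts θ) t) (str σ A) →
         (∀ {l} {Δ : Ctx l} ρ → Renaming ρ Γ Δ → ∀ {s} → Tests σ i Δ s →
            SN Δ any (subst ((rename ρ ∘ θ) ▹ s) t) (str σ A)) →
         W σ i Γ (IC σ Q (subst (exts θ) t))
  W-IC σ i {θ} t h k = IC h , λ ρ hρ {s} z →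
    expand [] (• (rename-SN (ext-renaming hρ) h) (Tests-SN σ i z))
      (SN-≡ (k ρ hρ z) (trans (cong (_[ s ]) (rename-subst (rename-subst-exts (λ _ → refl)) t))
                              (exts-single (rename ρ ∘ θ) t s)))

  -- Active variables are replaced by elements of W, the others by neutral terms.
  data Mark : Ty → Set where
    plain  : Mark P
    active : ∀ σ → Mark (cls σ A)

  Marks : Ctx n → Set
  Marks = All Mark

  level : Sign → ℕ → ℕ → ℕ
  level + i k = i
  level - i k = k

  -- A plain variable may have any type, so its substitute has to be neutral: then it can be
  -- eliminated without a hypothesis about that type.
  Value : ℕ → ℕ → Ctx n → Mark P → Term n → Set
  Value {P = P} i k Δ plain t = NE Δ t P
  Value i k Δ (active σ)    t = W σ (level σ i k) Δ t

  Value-rename : ∀ {i k} {ρ : Fin m → Fin n} → Renaming ρ Γ Δ → (c : Mark P) →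
                 Value i k Γ c t → Value i k Δ c (rename ρ t)
  Value-rename hρ plain v = rename-NE hρ v
  Value-rename {i = i} {k} hρ (active σ) v = Orthogonal-rename {Z = Tests σ (level σ i k)} hρ v

  Value-NE : ∀ {i k} (c : Mark P) → NE Γ t P → Value i k Γ c t
  Value-NE plain      h = h
  Value-NE (active σ) h = W-NE σ _ h

  Value-mono : ∀ {i j k l} → i ≤ j → k ≤ l → (c : Mark P) → Value i l Γ c t → Value j k Γ c t
  Value-mono i≤j k≤l plain      v = v
  Value-mono i≤j k≤l (active +) v = W⁺-mono i≤j v
  Value-mono i≤j k≤l (active -) v = W⁻-anti k≤l v

  record Environment {Γ : Ctx m} (M : Marks Γ) (i k : ℕ) (Δ : Ctx n) (θ : Fin m → Term n) : Set where
    constructor environment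
    field
      value : ∀ x → Value i k Δ (lookup⁺ M x) (θ x)

  open Environment

  private variable
    M   : Marks Γ
    c   : Mark P
    j k : ℕ
    θ   : Fin m → Term n

  Environment-mono : ∀ {i l} → i ≤ j → k ≤ l → Environment M i l Δ θ → Environment M j k Δ θ
  Environment-mono {M = M} i≤j k≤l E .value x = Value-mono i≤j k≤l (lookup⁺ M x) (E .value x)

  Environment-rename : ∀ {i} {ρ : Fin m → Fin n} → Renaming ρ Γ Δ →
                       Environment M i k Γ θ → Environment M i k Δ (rename ρ ∘ θ)
  Environment-rename {M = M} hρ E .value x = Value-rename hρ (lookup⁺ M x) (E .value x)

  Environment-▹ : ∀ {i} → Environment M i k Δ θ → Value i k Δ c s → Environment (c ∷ M) i k Δ (θ ▹ s)
  Environment-▹ E v .value zero    = v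
  Environment-▹ E v .value (suc x) = E .value x

  Environment-exts : ∀ {i} {c : Mark P} →
                     Environment M i k Δ θ → Environment (c ∷ M) i k (P ∷ Δ) (exts θ)
  Environment-exts {c = c} E .value zero    = Value-NE c (var zero refl)
  Environment-exts {M = M} E .value (suc x) = Value-rename (λ _ → refl) (lookup⁺ M x) (E .value x)

  Environment-var : ∀ {i} → Environment {Γ = Γ} M i k Γ var
  Environment-var {M = M} .value x = Value-NE (lookup⁺ M x) (var x refl)

  -- The levels i of the variables of type A ⊕ are given; those of the variables of type A ⊖ can
  -- be chosen as high as necessary.
  Eventually : {Γ : Ctx m} → Marks Γ → ℕ → (∀ {n} → Ctx n → (Fin m → Term n) → Set) → Set
  Eventually {m} M i Φ = ∃[ k ] (∀ {n} {Δ : Ctx n} {θ : Fin m → Term n} → Environment M i k Δ θ → Φ Δ θ)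

  -- Raising k is harmless because `W -` decreases, so the maximum meets both demands.
  both : ∀ {i} {Φ Ψ : ∀ {n} → Ctx n → (Fin m → Term n) → Set} →
         Eventually M i Φ → Eventually M i Ψ → Eventually M i (λ Δ θ → Φ Δ θ × Ψ Δ θ)
  both (k , f) (l , g) = k ⊔ l , λ E →
    f (Environment-mono ≤-refl (m≤m⊔n k l) E) , g (Environment-mono ≤-refl (m≤n⊔m k l) E)

  under : ∀ {i} {c : Mark P} {Φ : ∀ {n} → Ctx n → (Fin (suc m) → Term n) → Set} →
          Eventually (c ∷ M) i Φ → Eventually M i (λ Δ θ → Φ (P ∷ Δ) (exts θ))
  under (k , f) = k , λ E → f (Environment-exts E)

  -- The level cases arise for an active variable that is not yet applied. After its application the
  -- type is strong with proposition `A`, and `below` makes it eliminable. In `level⁻` every j must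
  -- be available, because the level needed depends on an argument met later.
  data Result {Γ : Ctx n} (M : Marks Γ) (i : ℕ) (t : Term n) : Ty → Set where
    eliminable : ∀ b → Eliminable b P → Eventually M i (λ Δ θ → SN Δ b (subst θ t) P) → Result M i t P
    level⁺     : Eventually M i (λ Δ θ → W + i Δ (subst θ t)) → Result M i t (cls + A)
    level⁻     : (∀ j → Eventually M i (λ Δ θ → W - j Δ (subst θ t))) → Result M i t (cls - A)

  result-var : ∀ {Γ : Ctx n} {M : Marks Γ} {i} x (c : Mark P) →
               (∀ {k m} {Δ : Ctx m} {θ} → Environment M i k Δ θ → Value i k Δ c (θ x)) →
               Result M i (var x) P
  result-var x plain      f = eliminable neutral _ (zero , λ E → ne (f E))
  result-var x (active +) f = level⁺ (zero , f)
  -- The demand for level j is passed on to the environment by choosing k = j.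
  result-var x (active -) f = level⁻ λ j → j , f

  eliminable-μ : ∀ b {B} → Eliminable b (str σ (neg B)) → Eliminable b (cls (opposite σ) B)
  eliminable-μ neutral _ = _
  eliminable-μ any     e = e

  eliminable-app : ∀ b {B} → Eliminable b (cls σ B) → Eliminable b (str σ B)
  eliminable-app neutral _       = _
  eliminable-app any     (_ , e) = e

  subst-SN    : ∀ {Γ : Ctx n} → SN Γ b t P → (M : Marks Γ) → ∀ i →
                Eventually M i (λ Δ θ → SN Δ any (subst θ t) P)
  subst-NE    : ∀ {Γ : Ctx n} → NE Γ t P → (M : Marks Γ) → ∀ i → Result M i t P
  subst-Redex : ∀ {Γ : Ctx n} → Redex Γ r r′ → (M : Marks Γ) → ∀ i →
                Eventually M i (λ Δ θ → Redex Δ (subst θ r) (subst θ r′))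
  subst-SN⁺   : ∀ {Γ : Ctx n} → SN Γ b t (cls + A) → (M : Marks Γ) → ∀ i →
                ∃[ j ] Eventually M i (λ Δ θ → W + j Δ (subst θ t))
  subst-SN⁻   : ∀ {Γ : Ctx n} → SN Γ b t (cls - A) → (M : Marks Γ) → ∀ i j →
                Eventually M i (λ Δ θ → W - j Δ (subst θ t))

  subst-SN (ne n) M i with subst-NE n M i
  ... | eliminable b e (k , f) = k , λ E → SN-any (f E)
  ... | level⁺ (k , f)         = k , λ E → proj₁ (f E)
  ... | level⁻ f               = let k , g = f zero in k , λ E → proj₁ (g E)
  subst-SN (expand {r = r} {r′} K red h) M i =
    let k , f = both (subst-Redex red M i) (subst-SN h M i)
    in k , λ {_} {_} {θ} E → let red′ , h′ = f E in
       SN-≡ (expand (substᴷ θ K) red′ (SN-≡ h′ (sym (subst-plug θ K r′)))) (subst-plug θ K r)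
  subst-SN (split K {s} {u} n d h₁ h₂) M i with subst-NE n M i
  ... | eliminable b e g =
    let k , f = both g (both (under (subst-SN h₁ (plain ∷ M) i)) (under (subst-SN h₂ (plain ∷ M) i)))
    in k , λ {_} {_} {θ} E → let n′ , h₁′ , h₂′ = f E in
       SN-≡ (SN-δ e d n′ (substᴷ θ K) (SN-≡ h₁′ (sym (subst-plug-↑ θ K s)))
                                      (SN-≡ h₂′ (sym (subst-plug-↑ θ K u))))
            (subst-plug θ K _)
  subst-SN (pair p h₁ h₂) M i =
    let k , f = both (subst-SN h₁ M i) (subst-SN h₂ M i)
    in k , λ E → pair p (proj₁ (f E)) (proj₂ (f E))
  subst-SN (inj d h) M i = let k , f = subst-SN h M i in k , λ E → inj d (f E)
  subst-SN (ν h) M i     = let k , f = subst-SN h M i in k , λ E → ν (f E)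
  subst-SN (IC h) M i    = let k , f = under (subst-SN h (plain ∷ M) i) in k , λ E → IC (f E)

  subst-NE (var x refl) M i = result-var x (lookup⁺ M x) (λ E → E .value x)
  subst-NE (app n h) M i with subst-NE n M i
  ... | eliminable b e g =
    let k , f = both g (subst-SN h M i)
    in eliminable b (eliminable-app b e) (k , λ E → SN-app e (proj₁ (f E)) (proj₂ (f E)))
  ... | level⁺ g =
    -- The head has level i, so its argument has to reach `W - i`.
    let k , f = both g (subst-SN⁻ h M i i)
    in eliminable any below (k , λ E → W-app + i (proj₁ (f E)) (proj₂ (f E)))
  ... | level⁻ g =
    -- Here the argument comes first: its level j decides that the head is taken at `suc j`, where
    -- the tests are `W + j`.
    let j , h′ = subst-SN⁺ h M i
        k , f  = both (g (suc j)) h′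
    in eliminable any below (k , λ E → W-app - (suc j) (proj₁ (f E)) (proj₂ (f E)))
  subst-NE (π {i = ι} p n) M i with subst-NE n M i
  ... | eliminable b e (k , f) = eliminable b (eliminable-π b p ι e) (k , λ E → SN-π p (f E))
  subst-NE (μ n) M i with subst-NE n M i
  ... | eliminable b e (k , f) = eliminable b (eliminable-μ b e) (k , λ E → SN-μ (f E))
  subst-NE (▶◀ˡ n h) M i with subst-NE n M i
  ... | eliminable b e g =
    let k , f = both g (subst-SN h M i)
    in eliminable neutral _ (k , λ E → SN-▶◀ e (proj₁ (f E)) (proj₂ (f E)))
  subst-NE (▶◀ʳ h n) M i with subst-NE n M i
  ... | eliminable neutral _ g =
    let k , f = both (subst-SN h M i) g
    in eliminable neutral _ (k , λ E → SN-▶◀ʳ (proj₁ (f E)) (proj₂ (f E)))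
  -- `Below` ignores the sign, so what is known for the right operand also serves the left one.
  ... | eliminable any e g =
    let k , f = both (subst-SN h M i) g
    in eliminable neutral _ (k , λ E → SN-▶◀ e (proj₁ (f E)) (proj₂ (f E)))

  subst-Redex (π {i = ι} h₁ h₂) M i =
    let k , f = both (subst-SN h₁ M i) (subst-SN h₂ M i)
    in k , λ {_} {_} {θ} E → Redex-≡ (π (proj₁ (f E)) (proj₂ (f E))) (subst-select θ ι _ _)
  subst-Redex (δ {t = t} {i = ι} {s = s} {u} K L h h₁ h₂) M i =
    let k , f = both (subst-SN h M i)
                     (both (under (subst-SN h₁ (plain ∷ M) i)) (under (subst-SN h₂ (plain ∷ M) i)))
    in k , λ {_} {_} {θ} E → let h′ , h₁′ , h₂′ = f E in Redex-≡
      (δ (substᴷ (exts θ) K) (substᴷ (exts θ) L) h′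
        (SN-≡ h₁′ (sym (subst-plug (exts θ) K s))) (SN-≡ h₂′ (sym (subst-plug (exts θ) L u))))
      (trans (subst-[] θ (select ι s u) t) (cong (_[ subst θ t ]) (subst-select (exts θ) ι s u)))
  subst-Redex (μ h) M i = let k , f = subst-SN h M i in k , λ E → μ (f E)
  subst-Redex (• {s = s} {t = t} h₁ h₂) M i =
    let k , f = both (under (subst-SN h₁ (plain ∷ M) i)) (subst-SN h₂ M i)
    in k , λ {_} {_} {θ} E → Redex-≡ (• (proj₁ (f E)) (proj₂ (f E))) (subst-[] θ t s)
  subst-Redex (pair {σ = σ} {Q = Q} {i = ι} h₁ h₂ h₃) M i =
    let k , f = both (subst-SN h₁ M i) (both (subst-SN h₂ M i) (subst-SN h₃ M i))
    in k , λ {_} {_} {θ} E → let h₁′ , h₂′ , h₃′ = f E in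
       Redex-≡ (pair h₁′ h₂′ h₃′) (cong (λ t → cut σ Q t _) (subst-select θ ι _ _))
  subst-Redex (inj {σ = σ} {i = ι} {Q = Q} h₁ h₂ h₃) M i =
    let k , f = both (subst-SN h₁ M i) (both (subst-SN h₂ M i) (subst-SN h₃ M i))
    in k , λ {_} {_} {θ} E → let h₁′ , h₂′ , h₃′ = f E in
       Redex-≡ (inj h₁′ h₂′ h₃′) (cong (cut σ Q _) (subst-select θ ι _ _))
  subst-Redex (ν h₁ h₂) M i =
    let k , f = both (subst-SN h₁ M i) (subst-SN h₂ M i)
    in k , λ E → ν (proj₁ (f E)) (proj₂ (f E))

  subst-SN⁺ (ne n) M i with subst-NE n M i
  ... | eliminable b e (k , f) = zero , k , λ E → W-eliminable + zero e (f E)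
  ... | level⁺ f               = i , f
  subst-SN⁺ (expand {r = r} {r′} K red h) M i =
    let j , h′ = subst-SN⁺ h M i
        k , f  = both (subst-Redex red M i) h′
    in j , k , λ {_} {_} {θ} E → let red′ , h″ = f E in
       W-≡ + j (W-expand + j (substᴷ θ K) red′ (W-≡ + j h″ (sym (subst-plug θ K r′)))) (subst-plug θ K r)
  subst-SN⁺ (split K {s} {u} n d h₁ h₂) M i with subst-NE n M i
  ... | eliminable b e g =
    let j₁ , g₁ = subst-SN⁺ h₁ (plain ∷ M) i
        j₂ , g₂ = subst-SN⁺ h₂ (plain ∷ M) i
        k , f   = both g (both (under g₁) (under g₂))
    in j₁ ⊔ j₂ , k , λ {_} {_} {θ} E → let n′ , h₁′ , h₂′ = f E in
       W-≡ + (j₁ ⊔ j₂) (W-split + (j₁ ⊔ j₂) e d n′ (substᴷ θ K)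
           (W-≡ + (j₁ ⊔ j₂) (W⁺-mono (m≤m⊔n j₁ j₂) h₁′) (sym (subst-plug-↑ θ K s)))
           (W-≡ + (j₁ ⊔ j₂) (W⁺-mono (m≤n⊔m j₁ j₂) h₂′) (sym (subst-plug-↑ θ K u))))
         (subst-plug θ K _)
  subst-SN⁺ (IC {t = t} h) M i =
    -- The k demanded by the body, now also for the bound variable, becomes the level of the
    -- abstraction: tests of `W + k` are in `W - k`.
    let k , f = subst-SN h (active - ∷ M) i
    in k , k , λ E → W-IC + k t (f (Environment-exts E)) λ ρ hρ z →
         f (Environment-▹ (Environment-rename hρ E) z)

  -- At level zero there are no tests; every other level has a predecessor, used for `IC` below.
  subst-SN⁻ h M i zero = let k , f = subst-SN h M i in k , λ E → f E , λ _ _ ()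
  subst-SN⁻ (ne n) M i j@(suc _) with subst-NE n M i
  ... | eliminable b e (k , f) = k , λ E → W-eliminable - j e (f E)
  ... | level⁻ f               = f j
  subst-SN⁻ (expand {r = r} {r′} K red h) M i j@(suc _) =
    let k , f = both (subst-Redex red M i) (subst-SN⁻ h M i j)
    in k , λ {_} {_} {θ} E → let red′ , h′ = f E in
       W-≡ - j (W-expand - j (substᴷ θ K) red′ (W-≡ - j h′ (sym (subst-plug θ K r′)))) (subst-plug θ K r)
  subst-SN⁻ (split K {s} {u} n d h₁ h₂) M i j@(suc _) with subst-NE n M i
  ... | eliminable b e g =
    let k , f = both g (both (under (subst-SN⁻ h₁ (plain ∷ M) i j))
                       (under (subst-SN⁻ h₂ (plain ∷ M) i j)))
    in k , λ {_} {_} {θ} E → let n′ , h₁′ , h₂′ = f E in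
       W-≡ - j (W-split - j e d n′ (substᴷ θ K) (W-≡ - j h₁′ (sym (subst-plug-↑ θ K s)))
                                                (W-≡ - j h₂′ (sym (subst-plug-↑ θ K u))))
         (subst-plug θ K _)
  subst-SN⁻ (IC {t = t} h) M i (suc j) =
    -- Tests of `W - (suc j)` are in `W + j`. All variables of type A ⊕ share one level, so the
    -- environment and the test are both raised to the maximum.
    let k , f = subst-SN h (active + ∷ M) (i ⊔ j)
    in k , λ E →
       let E′ = Environment-mono (m≤m⊔n i j) ≤-refl E in
       W-IC - (suc j) t (f (Environment-exts E′)) λ ρ hρ z →
         f (Environment-▹ (Environment-rename hρ E′) (W⁺-mono (m≤n⊔m i j) z))

  single-▹ : ∀ (s : Term n) x → single s x ≡ (var ▹ s) x
  single-▹ s zero    = refl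
  single-▹ s (suc x) = refl

  good : Good A
  good .absurdity h k = SN-▶◀ below h k
  good .sub {Γ = Γ} {σ = +} {s} {t} h g =
    -- The level j of the substituted term is found first and then prescribed for the variable;
    -- `zero` is a dummy, as no variable of `M` is active.
    let M          = universal (λ _ → plain) Γ
        j , l , g′ = subst-SN⁺ g M zero
        k , f      = subst-SN h (active + ∷ M) j
    in SN-≡ (f (Environment-▹ Environment-var (W-≡ + j (g′ Environment-var) (sym (subst-var s)))))
            (subst-cong (single-▹ s) t)
  good .sub {Γ = Γ} {σ = - } {s} {t} h g =
    -- Opposite order: `t` determines k, and the substituted term is then brought to level k.
    let M      = universal (λ _ → plain) Γ
        k , f  = subst-SN h (active - ∷ M) zero
        l , g′ = subst-SN⁻ g M zero k
    in SN-≡ (f (Environment-▹ Environment-var (W-≡ - k (g′ Environment-var) (sym (subst-var s)))))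
            (subst-cong (single-▹ s) t)

good-below : ∀ A → Good A × Below A
below-all : ∀ A → Below A
below-all (atom _) = _
below-all (A ∧ B)  = good-below A , good-below B
below-all (A ∨ B)  = good-below A , good-below B
below-all (neg A)  = good-below A
good-below A = Levels.good A (below-all A) , below-all A

-- Typable terms

⟦_⟧ : Type → Ty
⟦ A ⁺ ⟧ = str + A
⟦ A ⁻ ⟧ = str - A
⟦ A ⊕ ⟧ = cls + A
⟦ A ⊖ ⟧ = cls - A

typed-SN : ∀ {Γ : Context n} {P} → Γ ⊢ t ∶ P → SN (Vec.map ⟦_⟧ Γ) any t ⟦ P ⟧
typed-SN {Γ = Γ} (ax x) = ne (var x (lookup-map x ⟦_⟧ Γ))
typed-SN (abs {P = A ⁺} _ h k) = SN-any (SN-▶◀ (below-all A) (typed-SN h) (typed-SN k))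
typed-SN (abs {P = A ⁻} _ h k) = SN-any (SN-▶◀ (below-all A) (typed-SN h) (typed-SN k))
typed-SN (I∧⁺ h k)   = pair ∧⁺ (typed-SN h) (typed-SN k)
typed-SN (I∨⁻ h k)   = pair ∨⁻ (typed-SN h) (typed-SN k)
typed-SN (E∧⁺ i h)   = SN-π ∧⁺ (typed-SN h)
typed-SN (E∨⁻ i h)   = SN-π ∨⁻ (typed-SN h)
typed-SN (I∨⁺ i h)   = inj ∨⁺ (typed-SN h)
typed-SN (I∧⁻ i h)   = inj ∧⁻ (typed-SN h)
typed-SN (E∨⁺ {A = A} {B} h k l) = SN-δ (below-all (A ∨ B)) ∨⁺ (typed-SN h) [] (typed-SN k) (typed-SN l)
typed-SN (E∧⁻ {A = A} {B} h k l) = SN-δ (below-all (A ∧ B)) ∧⁻ (typed-SN h) [] (typed-SN k) (typed-SN l)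
typed-SN (I¬⁺ h)     = ν (typed-SN h)
typed-SN (I¬⁻ h)     = ν (typed-SN h)
typed-SN (E¬⁺ h)     = SN-μ (typed-SN h)
typed-SN (E¬⁻ h)     = SN-μ (typed-SN h)
typed-SN (IC⁺ h)     = IC (typed-SN h)
typed-SN (IC⁻ h)     = IC (typed-SN h)
typed-SN (EC⁺ {A = A} h k) = SN-app (good-below A) (typed-SN h) (typed-SN k)
typed-SN (EC⁻ {A = A} h k) = SN-app (good-below A) (typed-SN h) (typed-SN k)

sn⇒finite : sn t → ¬ (Σ[ f ∈ (ℕ → Term n) ] (f zero ≡ t × (∀ (k : ℕ) → f k ⟶ f (suc k))))
sn⇒finite (acc a) (f , refl , st) = sn⇒finite (a (st zero)) (f ∘ suc , refl , st ∘ suc)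

theorem32 : ∀ {n : ℕ} (t : Term n) → Typable t →
    ¬ (Σ[ f ∈ (ℕ → Term n) ] (f zero ≡ t × (∀ (k : ℕ) → f k ⟶ f (suc k))))
theorem32 t (Γ , P , h) = sn⇒finite (SN⇒sn (typed-SN h))
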